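{- Let $a\geq 15$ be an integer, let $\rho$ be the root greater than $a+1$ of $x^3-ax^2-(a+3)x-1$, and let $\gamma=a^2+a+8+(a^2-a+1)\rho+(2-a)\rho^2\in\mathbb{Z}[\rho]$. Let $\omega\in\mathbb{Z}[\rho]$ be nonzero with $\gamma\succeq\omega^2$. If $\omega$ is $\sigma$-decomposable in $\mathbb{Z}[\rho]$ for some signature $\sigma$, then $\omega^2\in\{4,9\}$.
   Context: The polynomial $x^3-ax^2-(a+3)x-1$ is irreducible over $\mathbb{Q}$ with three real roots $\rho,\rho',\rho''$, labelled so that $a+1<\rho$, $-2<\rho'<-1$, $-1<\rho''<0$. The field $K=\mathbb{Q}(\rho)$ is cyclic cubic; for $\alpha\in K$, $\alpha'$ and $\alpha''$ denote the images of $\alpha$ under the $\mathbb{Q}$-isomorphisms given by $\rho\mapsto\rho'$ and $\rho\mapsto\rho''$ respectively. The signature of a nonzero $\alpha\in K$ is the triple $(\mathrm{sgn}(\alpha),\mathrm{sgn}(\alpha'),\mathrm{sgn}(\alpha''))\in\{+,-\}^3$. For a signature $\sigma\in\{+,-\}^3$, $\mathbb{Z}[\rho]^{\sigma}$ is the set of elements of $\mathbb{Z}[\rho]$ with signature $\sigma$. An element $\alpha\in\mathbb{Z}[\rho]^{\sigma}$ is $\sigma$-decomposable in $\mathbb{Z}[\rho]$ if it can be written as $\alpha=\beta_1+\beta_2$ with $\beta_1,\beta_2\in\mathbb{Z}[\rho]^{\sigma}$. An element is totally positive if it has signature $(+,+,+)$. For totally positive $\alpha,\beta\in\mathbb{Z}[\rho]$,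 $\alpha\succ\beta$ means $\alpha>\beta$, $\alpha'>\beta'$ and $\alpha''>\beta''$; $\alpha\succeq\beta$ means $\alpha\succ\beta$ or $\alpha=\beta$. -}

module Defs where

open import Data.Integer as ℤ using (ℤ; +_)
open import Data.Nat as ℕ using (ℕ)
import Data.Nat.Properties as ℕ
open import Data.Product using (∃-syntax; _×_; _,_)
open import Data.Rational as ℚ using (ℚ; 0ℚ; 1ℚ; ½; ∣_∣)
import Data.Rational.Properties as ℚ
open import Data.Rational.Solver using (module +-*-Solver)
open import Data.Sign using (Sign)
open import Data.Sum using (_⊎_)
open import Relation.Binary.PropositionalEquality
  using (_≡_; refl; sym; trans; cong; cong₂; subst)

-- The real numbers: Cauchy sequences of rationals, with pointwise operations
-- and with limit equality _≈ℝ_ in place of a quotient.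

IsCauchy : (ℕ → ℚ) → Set
IsCauchy x = ∀ ε → 0ℚ ℚ.< ε →
  ∃[ N ] (∀ m n → N ℕ.≤ m → N ℕ.≤ n → ∣ x m ℚ.- x n ∣ ℚ.< ε)

record ℝ : Set where
  constructor mkℝ
  field
    seq    : ℕ → ℚ
    cauchy : IsCauchy seq

open ℝ public

infix 4 _≈ℝ_ _<ℝ_

_≈ℝ_ : ℝ → ℝ → Set
x ≈ℝ y = ∀ ε → 0ℚ ℚ.< ε →
  ∃[ N ] (∀ n → N ℕ.≤ n → ∣ seq x n ℚ.- seq y n ∣ ℚ.< ε)

-- Eventually separated by a fixed positive rational; the pointwise strict
-- inequality would not respect _≈ℝ_.
_<ℝ_ : ℝ → ℝ → Set
x <ℝ y = ∃[ ε ] (0ℚ ℚ.< ε ×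
  ∃[ N ] (∀ n → N ℕ.≤ n → seq x n ℚ.+ ε ℚ.≤ seq y n))

module CauchyLemmas where

  half-pos : ∀ {ε} → 0ℚ ℚ.< ε → 0ℚ ℚ.< ½ ℚ.* ε
  half-pos {ε} 0<ε =
    subst (ℚ._< ½ ℚ.* ε) (ℚ.*-zeroʳ ½) (ℚ.*-monoʳ-<-pos ½ 0<ε)

  half+half : ∀ ε → ½ ℚ.* ε ℚ.+ ½ ℚ.* ε ≡ ε
  half+half ε = trans (sym (ℚ.*-distribʳ-+ ε ½ ½)) (ℚ.*-identityˡ ε)

  const-cauchy : ∀ q → IsCauchy (λ _ → q)
  const-cauchy q ε 0<ε =
    0 , λ _ _ _ _ → subst (λ d → ∣ d ∣ ℚ.< ε) (sym (ℚ.+-inverseʳ q)) 0<ε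

  +-cauchy : ∀ x y → IsCauchy x → IsCauchy y → IsCauchy (λ n → x n ℚ.+ y n)
  +-cauchy x y cx cy ε 0<ε with cx _ (half-pos 0<ε) | cy _ (half-pos 0<ε)
  ... | M , hx | N , hy = M ℕ.⊔ N , λ m n m≥ n≥ → begin-strict
    ∣ (x m ℚ.+ y m) ℚ.- (x n ℚ.+ y n) ∣
      ≡⟨ cong ∣_∣ (rearrange (x m) (y m) (x n) (y n)) ⟩
    ∣ (x m ℚ.- x n) ℚ.+ (y m ℚ.- y n) ∣
      ≤⟨ ℚ.∣p+q∣≤∣p∣+∣q∣ (x m ℚ.- x n) (y m ℚ.- y n) ⟩
    ∣ x m ℚ.- x n ∣ ℚ.+ ∣ y m ℚ.- y n ∣
      <⟨ ℚ.+-mono-<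
           (hx m n (ℕ.m⊔n≤o⇒m≤o M N m≥) (ℕ.m⊔n≤o⇒m≤o M N n≥))
           (hy m n (ℕ.m⊔n≤o⇒n≤o M N m≥) (ℕ.m⊔n≤o⇒n≤o M N n≥)) ⟩
    ½ ℚ.* ε ℚ.+ ½ ℚ.* ε
      ≡⟨ half+half ε ⟩
    ε ∎
    where
    open ℚ.≤-Reasoning
    rearrange : ∀ a b c d →
      (a ℚ.+ b) ℚ.- (c ℚ.+ d) ≡ (a ℚ.- c) ℚ.+ (b ℚ.- d)
    rearrange = solve 4 (λ a b c d →
      (a :+ b) :- (c :+ d) := (a :- c) :+ (b :- d)) refl
      where open +-*-Solver

  neg-cauchy : ∀ x → IsCauchy x → IsCauchy (λ n → ℚ.- x n)
  neg-cauchy x cx ε 0<ε with cx ε 0<ε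
  ... | N , hx = N , λ m n m≥ n≥ → subst (ℚ._< ε)
    (trans (sym (ℚ.∣-p∣≡∣p∣ (x m ℚ.- x n)))
           (cong ∣_∣ (ℚ.neg-distrib-+ (x m) (ℚ.- x n))))
    (hx m n m≥ n≥)

  eventually-bounded : ∀ x → IsCauchy x →
    ∃[ B ] (0ℚ ℚ.< B × ∃[ N ] (∀ n → N ℕ.≤ n → ∣ x n ∣ ℚ.≤ B))
  eventually-bounded x cx with cx 1ℚ (ℚ.positive⁻¹ 1ℚ)
  ... | N , hx = 1ℚ ℚ.+ ∣ x N ∣
    , ℚ.+-mono-<-≤ (ℚ.positive⁻¹ 1ℚ) (ℚ.0≤∣p∣ (x N))
    , N , λ n n≥ → begin
      ∣ x n ∣                            ≡⟨ cong ∣_∣ (split (x n) (x N)) ⟩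
      ∣ (x n ℚ.- x N) ℚ.+ x N ∣          ≤⟨ ℚ.∣p+q∣≤∣p∣+∣q∣ (x n ℚ.- x N) (x N) ⟩
      ∣ x n ℚ.- x N ∣ ℚ.+ ∣ x N ∣
        ≤⟨ ℚ.+-monoˡ-≤ ∣ x N ∣ (ℚ.<⇒≤ (hx n N n≥ ℕ.≤-refl)) ⟩
      1ℚ ℚ.+ ∣ x N ∣ ∎
    where
    open ℚ.≤-Reasoning
    split : ∀ a b → a ≡ (a ℚ.- b) ℚ.+ b
    split = solve 2 (λ a b → a := (a :- b) :+ b) refl
      where open +-*-Solver

  0<p*q : ∀ {p q} → 0ℚ ℚ.< p → 0ℚ ℚ.< q → 0ℚ ℚ.< p ℚ.* q
  0<p*q {p} {q} 0<p 0<q =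
    subst (ℚ._< p ℚ.* q) (ℚ.*-zeroʳ p)
      (ℚ.*-monoʳ-<-pos p {{ℚ.positive 0<p}} 0<q)

  -- For B, ε > 0 some δ > 0 has B δ = ε.
  quotient : ∀ {B ε} → 0ℚ ℚ.< B → 0ℚ ℚ.< ε →
    ∃[ δ ] (0ℚ ℚ.< δ × B ℚ.* δ ≡ ε)
  quotient {B} {ε} 0<B 0<ε = B⁻¹ ℚ.* ε
    , 0<p*q (ℚ.positive⁻¹ B⁻¹ {{ℚ.1/pos⇒pos B}}) 0<ε
    , trans (sym (ℚ.*-assoc B B⁻¹ ε))
        (trans (cong (ℚ._* ε) (ℚ.*-inverseʳ B)) (ℚ.*-identityˡ ε))
    where
    instance
      B-pos : ℚ.Positive B
      B-pos = ℚ.positive 0<B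
      B-nonZero : ℚ.NonZero B
      B-nonZero = ℚ.pos⇒nonZero B
    B⁻¹ : ℚ
    B⁻¹ = ℚ.1/ B

  ∣p*q∣-bound : ∀ {B δ p q} → 0ℚ ℚ.< B → ∣ p ∣ ℚ.≤ B → ∣ q ∣ ℚ.< δ →
    ∣ p ℚ.* q ∣ ℚ.< B ℚ.* δ
  ∣p*q∣-bound {B} {δ} {p} {q} 0<B p≤B q<δ = begin-strict
    ∣ p ℚ.* q ∣       ≡⟨ ℚ.∣p*q∣≡∣p∣*∣q∣ p q ⟩
    ∣ p ∣ ℚ.* ∣ q ∣   ≤⟨ ℚ.*-monoʳ-≤-nonNeg ∣ q ∣ {{ℚ.∣-∣-nonNeg q}} p≤B ⟩
    B ℚ.* ∣ q ∣       <⟨ ℚ.*-monoʳ-<-pos B {{ℚ.positive 0<B}} q<δ ⟩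
    B ℚ.* δ           ∎
    where open ℚ.≤-Reasoning

  product-close : ∀ {A B α β ε} p q r s → 0ℚ ℚ.< A → 0ℚ ℚ.< B →
    A ℚ.* α ≡ ½ ℚ.* ε → B ℚ.* β ≡ ½ ℚ.* ε →
    ∣ p ∣ ℚ.≤ A → ∣ s ∣ ℚ.≤ B → ∣ q ℚ.- s ∣ ℚ.< α → ∣ p ℚ.- r ∣ ℚ.< β →
    ∣ p ℚ.* q ℚ.- r ℚ.* s ∣ ℚ.< ε
  product-close {A} {B} {α} {β} {ε} p q r s 0<A 0<B Aα≡ Bβ≡ p≤A s≤B q-s<α p-r<β =
    begin-strict
    ∣ p ℚ.* q ℚ.- r ℚ.* s ∣
      ≡⟨ cong ∣_∣ (rearrange p q r s) ⟩
    ∣ p ℚ.* (q ℚ.- s) ℚ.+ s ℚ.* (p ℚ.- r) ∣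
      ≤⟨ ℚ.∣p+q∣≤∣p∣+∣q∣ (p ℚ.* (q ℚ.- s)) (s ℚ.* (p ℚ.- r)) ⟩
    ∣ p ℚ.* (q ℚ.- s) ∣ ℚ.+ ∣ s ℚ.* (p ℚ.- r) ∣
      <⟨ ℚ.+-mono-<
           (∣p*q∣-bound {p = p} {q = q ℚ.- s} 0<A p≤A q-s<α)
           (∣p*q∣-bound {p = s} {q = p ℚ.- r} 0<B s≤B p-r<β) ⟩
    A ℚ.* α ℚ.+ B ℚ.* β
      ≡⟨ cong₂ ℚ._+_ Aα≡ Bβ≡ ⟩
    ½ ℚ.* ε ℚ.+ ½ ℚ.* ε
      ≡⟨ half+half ε ⟩
    ε ∎
    where
    open ℚ.≤-Reasoning
    rearrange : ∀ a b c d →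
      a ℚ.* b ℚ.- c ℚ.* d ≡ a ℚ.* (b ℚ.- d) ℚ.+ d ℚ.* (a ℚ.- c)
    rearrange = solve 4 (λ a b c d →
      a :* b :- c :* d := a :* (b :- d) :+ d :* (a :- c)) refl
      where open +-*-Solver

  *-cauchy : ∀ x y → IsCauchy x → IsCauchy y → IsCauchy (λ n → x n ℚ.* y n)
  *-cauchy x y cx cy ε 0<ε =
    let A , 0<A , K , x≤A = eventually-bounded x cx
        B , 0<B , L , y≤B = eventually-bounded y cy
        α , 0<α , Aα≡ = quotient 0<A (half-pos 0<ε)
        β , 0<β , Bβ≡ = quotient 0<B (half-pos 0<ε)
        M , hx = cx β 0<β
        N , hy = cy α 0<α
        KL = K ℕ.⊔ L
        MN = M ℕ.⊔ N
    in KL ℕ.⊔ MN , λ m n m≥ n≥ →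
      let m≥MN = ℕ.m⊔n≤o⇒n≤o KL MN m≥
          n≥MN = ℕ.m⊔n≤o⇒n≤o KL MN n≥
      in product-close (x m) (y m) (x n) (y n) 0<A 0<B Aα≡ Bβ≡
           (x≤A m (ℕ.m⊔n≤o⇒m≤o K L (ℕ.m⊔n≤o⇒m≤o KL MN m≥)))
           (y≤B n (ℕ.m⊔n≤o⇒n≤o K L (ℕ.m⊔n≤o⇒m≤o KL MN n≥)))
           (hy m n (ℕ.m⊔n≤o⇒n≤o M N m≥MN) (ℕ.m⊔n≤o⇒n≤o M N n≥MN))
           (hx m n (ℕ.m⊔n≤o⇒m≤o M N m≥MN) (ℕ.m⊔n≤o⇒m≤o M N n≥MN))

open CauchyLemmas

infixl 6 _+ℝ_ _-ℝ_
infixl 7 _*ℝ_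
infix  8 -ℝ_

fromℤ : ℤ → ℝ
fromℤ i = mkℝ (λ _ → i ℚ./ 1) (const-cauchy (i ℚ./ 1))

_+ℝ_ : ℝ → ℝ → ℝ
x +ℝ y = mkℝ (λ n → seq x n ℚ.+ seq y n)
  (+-cauchy (seq x) (seq y) (cauchy x) (cauchy y))

-ℝ_ : ℝ → ℝ
-ℝ x = mkℝ (λ n → ℚ.- seq x n) (neg-cauchy (seq x) (cauchy x))

_-ℝ_ : ℝ → ℝ → ℝ
x -ℝ y = x +ℝ (-ℝ y)

_*ℝ_ : ℝ → ℝ → ℝ
x *ℝ y = mkℝ (λ n → seq x n ℚ.* seq y n)
  (*-cauchy (seq x) (seq y) (cauchy x) (cauchy y))

0ℝ : ℝ
0ℝ = fromℤ (+ 0)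

cubic : ℤ → ℝ → ℝ
cubic a x =
  x *ℝ x *ℝ x -ℝ fromℤ a *ℝ (x *ℝ x) -ℝ fromℤ (a ℤ.+ + 3) *ℝ x -ℝ fromℤ (+ 1)

record Roots (a : ℤ) : Set where
  field
    ρ ρ′ ρ″   : ℝ
    ρ-root    : cubic a ρ  ≈ℝ 0ℝ
    ρ′-root   : cubic a ρ′ ≈ℝ 0ℝ
    ρ″-root   : cubic a ρ″ ≈ℝ 0ℝ
    a+1<ρ     : fromℤ (a ℤ.+ + 1) <ℝ ρ
    -2<ρ′     : fromℤ (ℤ.- + 2) <ℝ ρ′
    ρ′<-1     : ρ′ <ℝ fromℤ (ℤ.- + 1)
    -1<ρ″     : fromℤ (ℤ.- + 1) <ℝ ρ″
    ρ″<0      : ρ″ <ℝ 0ℝ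

-- ⟨ x , y , z ⟩ stands for x + yρ + zρ².  As the cubic is monic and irreducible
-- over ℚ, every element of ℤ[ρ] is of this form for exactly one triple, so
-- equality in ℤ[ρ] is _≡_.
record ℤ[ρ] : Set where
  constructor ⟨_,_,_⟩
  field
    c₀ c₁ c₂ : ℤ

infixl 6 _+ρ_

ι : ℤ → ℤ[ρ]
ι n = ⟨ n , + 0 , + 0 ⟩

_+ρ_ : ℤ[ρ] → ℤ[ρ] → ℤ[ρ]
⟨ x , y , z ⟩ +ρ ⟨ u , v , w ⟩ = ⟨ x ℤ.+ u , y ℤ.+ v , z ℤ.+ w ⟩

scale : ℤ → ℤ[ρ] → ℤ[ρ]
scale n ⟨ x , y , z ⟩ = ⟨ n ℤ.* x , n ℤ.* y , n ℤ.* z ⟩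

-- Evaluation at t = ρ, ρ′, ρ″ gives α, α′, α″ respectively.
eval : ℝ → ℤ[ρ] → ℝ
eval t ⟨ x , y , z ⟩ = fromℤ x +ℝ fromℤ y *ℝ t +ℝ fromℤ z *ℝ (t *ℝ t)

module Arithmetic (a : ℤ) where

  infixl 7 _*ρ_

  -- Multiplication by ρ, from ρ³ = 1 + (a + 3) ρ + a ρ².
  ρ·_ : ℤ[ρ] → ℤ[ρ]
  ρ· ⟨ x , y , z ⟩ = ⟨ z , x ℤ.+ (a ℤ.+ + 3) ℤ.* z , y ℤ.+ a ℤ.* z ⟩

  _*ρ_ : ℤ[ρ] → ℤ[ρ] → ℤ[ρ]
  ⟨ x , y , z ⟩ *ρ β = scale x β +ρ scale y (ρ· β) +ρ scale z (ρ· (ρ· β))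

  γ : ℤ[ρ]
  γ = ⟨ a ℤ.* a ℤ.+ a ℤ.+ + 8 , a ℤ.* a ℤ.- a ℤ.+ + 1 , + 2 ℤ.- a ⟩

Signature : Set
Signature = Sign × Sign × Sign

-- A relation, because the sign of a real number is not computable.
HasSign : ℝ → Sign → Set
HasSign x Sign.+ = 0ℝ <ℝ x
HasSign x Sign.- = x <ℝ 0ℝ

module Embedded {a : ℤ} (R : Roots a) where

  open Roots R

  infix 4 _≻_ _⪰_

  HasSignature : ℤ[ρ] → Signature → Set
  HasSignature α (s , s′ , s″) =
    HasSign (eval ρ α) s × HasSign (eval ρ′ α) s′ × HasSign (eval ρ″ α) s″

  Decomposable : Signature → ℤ[ρ] → Set
  Decomposable σ α = HasSignature α σ ×
    ∃[ β₁ ] ∃[ β₂ ] (HasSignature β₁ σ × HasSignature β₂ σ × α ≡ β₁ +ρ β₂)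

  _≻_ : ℤ[ρ] → ℤ[ρ] → Set
  α ≻ β =
    eval ρ β <ℝ eval ρ α × eval ρ′ β <ℝ eval ρ′ α × eval ρ″ β <ℝ eval ρ″ α

  _⪰_ : ℤ[ρ] → ℤ[ρ] → Set
  α ⪰ β = α ≻ β ⊎ α ≡ β

{-# OPTIONS --safe #-}
module Submission where

-- At a late index the Cauchy sequences of ρ, ρ′, ρ″ become rational numbers
-- a+1+u, −1−t, −s at which the cubic is negligible compared with t > 0, and every
-- strict inequality used below already holds there.  The condition γ ⪰ ω² bounds
-- the conjugates of ω by a+2, 3+3t/4 and a+1/2, and up to sign the only nonzero
-- elements of ℤ[ρ] within these bounds are
--   1, 2, 3, ρ−1, ρ, −(a+1)−aρ+ρ², −a−aρ+ρ², −(a+1)−(a+1)ρ+ρ².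
-- Each of them except 2 and 3 is indecomposable: some additive φ : ℤ[ρ] → ℤ is
-- positive on all elements of its signature and takes the value 1 on it.  By
-- Lagrange interpolation φ is a combination of the three evaluations, so that its
-- positivity on a signature is read off the signs of three coefficients.

open import Defs
open import Data.Empty using (⊥-elim)
open import Data.Integer as ℤ using (ℤ; +_; -[1+_])
import Data.Integer.Properties as ℤ
import Data.Integer.Tactic.RingSolver as ℤ-Solver
open import Data.List using ([]; _∷_)
open import Data.Maybe using (Maybe; just; nothing)
open import Data.Nat as ℕ using (ℕ; suc; s≤s)
import Data.Nat.Coprimality as ℕ
import Data.Nat.Properties as ℕ
open import Data.Product using (∃-syntax; _×_; _,_; proj₁; proj₂)
open import Data.Rational
open import Data.Rational.Literals using (number) renaming (fromℤ to _⁄1)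
open import Data.Rational.Properties
open import Data.Sign using (Sign)
open import Data.Sum as Sum using (_⊎_; inj₁; inj₂)
open import Relation.Binary.PropositionalEquality
  using (_≡_; _≢_; refl; sym; trans; cong; cong₂; subst; subst₂)
open import Relation.Nullary using (¬_; yes; no)
open import Tactic.RingSolver using (solve)
open import Tactic.RingSolver.Core.AlmostCommutativeRing
  using (AlmostCommutativeRing; fromCommutativeRing)

open CauchyLemmas using (eventually-bounded; quotient; ∣p*q∣-bound; 0<p*q)

-- Certificates of positivity

ℚ-ring : AlmostCommutativeRing _ _
ℚ-ring = fromCommutativeRing +-*-commutativeRing isZero
  where
  isZero : ∀ p → Maybe (0ℚ ≡ p)
  isZero p with 0ℚ ≟ p
  ... | yes e = just e
  ... | no _ = nothing

infixl 6 _⊕_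
infixl 7 _⊗_

_⊕_ : ∀ {p q} → 0ℚ < p → 0ℚ < q → 0ℚ < p + q
_⊕_ = +-mono-<

_⊗_ : ∀ {p q} → 0ℚ < p → 0ℚ < q → 0ℚ < p * q
_⊗_ = 0<p*q

lit : ∀ p {0<p : Positive p} → 0ℚ < p
lit p {0<p} = positive⁻¹ p {{0<p}}

gap : ∀ {p q} → p < q → 0ℚ < q - p
gap {p} {q} p<q = subst (_< q - p) (+-inverseʳ p) (+-monoˡ-< (- p) p<q)

from-gap : ∀ {p q} → 0ℚ < q - p → p < q
from-gap {p} {q} 0<q-p = subst₂ _<_ (+-identityˡ p) eq (+-monoˡ-< p 0<q-p)
  where
  eq : q - p + p ≡ q
  eq = solve (p ∷ q ∷ []) ℚ-ring

cancel-pos : ∀ {k p} → 0ℚ < k → 0ℚ < k * p → 0ℚ < p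
cancel-pos {k} {p} 0<k 0<kp = *-cancelˡ-<-nonNeg k
  {{pos⇒nonNeg k {{positive 0<k}}}} (subst (_< k * p) (sym (*-zeroʳ k)) 0<kp)

-- A strict inequality is proved by writing a positive multiple of q − p as a sum of
-- products of quantities already known to be positive.
certify : ∀ {k c p q} → 0ℚ < k → 0ℚ < c → k * (q - p) ≡ c → p < q
certify 0<k 0<c eq = from-gap (cancel-pos 0<k (subst (0ℚ <_) (sym eq) 0<c))

square< : ∀ w b → 0ℚ < b → w * w < b * b → w < b
square< w b 0<b w²<b² = ≰⇒> λ b≤w → <-irrefl refl (<-≤-trans w²<b²
  (≤-trans (*-monoˡ-≤-nonNeg b {{pos⇒nonNeg b {{positive 0<b}}}} b≤w)
           (*-monoʳ-≤-nonNeg w {{nonNegative (≤-trans (<⇒≤ 0<b) b≤w)}} b≤w)))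

square-bound : ∀ k w b → 0ℚ < k → 0ℚ < b → k * (w * w) < k * (b * b) →
  - b < w × w < b
square-bound k w b 0<k 0<b h =
  certify (lit 1ℚ) (gap (square< (- w) b 0<b -w²<b²)) (solve (w ∷ b ∷ []) ℚ-ring)
    , square< w b 0<b w²<b²
  where
  w²<b² : w * w < b * b
  w²<b² = *-cancelˡ-<-nonNeg k {{pos⇒nonNeg k {{positive 0<k}}}} h
  -w²<b² : - w * - w < b * b
  -w²<b² = certify (lit 1ℚ) (gap w²<b²) (solve (w ∷ b ∷ []) ℚ-ring)

module RationalEstimates where
  open import Agda.Builtin.FromNat
  open import Data.Unit using (tt)
  instance
    _ = number

  -- The expressions in e₁, e₂, e₃ are the values of the cubic at A+1+u, −1−t, −s.
  record Approximation (A u t s : ℚ) : Set where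
    field
      149<10A : 149 < 10 * A
      0<u : 0 < u
      0<t : 0 < t
      t<1 : t < 1
      0<s : 0 < s
      s<1 : s < 1
      e₁< : 100 * A * (u * (A * A + 3 * A) + u * u * (2 * A + 3) + u * u * u - 2 * A - 3) < t
      e₁> : - t < 100 * A * (u * (A * A + 3 * A) + u * u * (2 * A + 3) + u * u * u - 2 * A - 3)
      e₂< : 100 * A * (1 - A * t - (A + 3) * t * t - t * t * t) < t
      e₂> : - t < 100 * A * (1 - A * t - (A + 3) * t * t - t * t * t)
      e₃< : 100 * A * ((A + 3) * s - A * s * s - s * s * s - 1) < t
      e₃> : - t < 100 * A * ((A + 3) * s - A * s * s - s * s * s - 1)

  approximation : ∀ {A u t s η} → 149 < 10 * A → 0 < u → 0 < s → s < 1 →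
    0 < η → η ≤ t → t < 1 →
    - η < 100 * A * ((A + 1 + u) * (A + 1 + u) * (A + 1 + u)
      - A * ((A + 1 + u) * (A + 1 + u)) - (A + 3) * (A + 1 + u) - 1) ×
      100 * A * ((A + 1 + u) * (A + 1 + u) * (A + 1 + u)
      - A * ((A + 1 + u) * (A + 1 + u)) - (A + 3) * (A + 1 + u) - 1) < η →
    - η < 100 * A * ((- 1 - t) * (- 1 - t) * (- 1 - t)
      - A * ((- 1 - t) * (- 1 - t)) - (A + 3) * (- 1 - t) - 1) ×
      100 * A * ((- 1 - t) * (- 1 - t) * (- 1 - t)
      - A * ((- 1 - t) * (- 1 - t)) - (A + 3) * (- 1 - t) - 1) < η →
    - η < 100 * A * ((- s) * (- s) * (- s)
      - A * ((- s) * (- s)) - (A + 3) * (- s) - 1) ×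
      100 * A * ((- s) * (- s) * (- s)
      - A * ((- s) * (- s)) - (A + 3) * (- s) - 1) < η →
    Approximation A u t s
  approximation {A} {u} {t} {s} {η} 149<10A 0<u 0<s s<1 0<η η≤t t<1
    (l₁ , h₁) (l₂ , h₂) (l₃ , h₃) = record
    { 149<10A = 149<10A
    ; 0<u = 0<u
    ; 0<t = <-≤-trans 0<η η≤t
    ; t<1 = t<1
    ; 0<s = 0<s
    ; s<1 = s<1
    ; e₁< = subst (λ e → 100 * A * e < t) eq₁ (<-≤-trans h₁ η≤t)
    ; e₁> = subst (λ e → - t < 100 * A * e) eq₁ (≤-<-trans -t≤-η l₁)
    ; e₂< = subst (λ e → 100 * A * e < t) eq₂ (<-≤-trans h₂ η≤t)
    ; e₂> = subst (λ e → - t < 100 * A * e) eq₂ (≤-<-trans -t≤-η l₂)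
    ; e₃< = subst (λ e → 100 * A * e < t) eq₃ (<-≤-trans h₃ η≤t)
    ; e₃> = subst (λ e → - t < 100 * A * e) eq₃ (≤-<-trans -t≤-η l₃)
    }
    where
    -t≤-η : - t ≤ - η
    -t≤-η = neg-antimono-≤ η≤t
    eq₁ : (A + 1 + u) * (A + 1 + u) * (A + 1 + u)
      - A * ((A + 1 + u) * (A + 1 + u)) - (A + 3) * (A + 1 + u) - 1
      ≡ u * (A * A + 3 * A) + u * u * (2 * A + 3) + u * u * u - 2 * A - 3
    eq₁ = solve (A ∷ u ∷ []) ℚ-ring
    eq₂ : (- 1 - t) * (- 1 - t) * (- 1 - t)
      - A * ((- 1 - t) * (- 1 - t)) - (A + 3) * (- 1 - t) - 1
      ≡ 1 - A * t - (A + 3) * t * t - t * t * t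
    eq₂ = solve (A ∷ t ∷ []) ℚ-ring
    eq₃ : (- s) * (- s) * (- s) - A * ((- s) * (- s)) - (A + 3) * (- s) - 1
      ≡ (A + 3) * s - A * s * s - s * s * s - 1
    eq₃ = solve (A ∷ s ∷ []) ℚ-ring

  module Estimates {A u t s : ℚ} (approx : Approximation A u t s) where

    open Approximation approx

    0<A : 0 < A
    0<A = certify (lit 10) (gap 149<10A ⊕ lit 149) (solve (A ∷ []) ℚ-ring)

    14t<1 : 14 * t < 1
    14t<1 = certify (lit 100 ⊗ 0<A ⊗ 0<A)
      (lit 10 ⊗ 0<A ⊗ gap 149<10A ⊕ lit 9 ⊗ gap 149<10A ⊕ lit 1327
       ⊕ lit 14 ⊗ (gap t<1 ⊕ gap e₂>)
       ⊕ lit 1400 ⊗ 0<A ⊗ ((0<A ⊕ lit 3) ⊗ 0<t ⊗ 0<t ⊕ 0<t ⊗ 0<t ⊗ 0<t))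
      (solve (A ∷ t ∷ []) ℚ-ring)

    14<A : 14 < A
    14<A = certify (lit 10) (gap 149<10A ⊕ lit 9) (solve (A ∷ []) ℚ-ring)

    8u<1 : 8 * u < 1
    8u<1 = certify (lit 100 ⊗ 0<A ⊗ (0<A ⊗ 0<A ⊕ lit 3 ⊗ 0<A))
      (0<A ⊗ (gap 149<10A ⊗ gap 149<10A ⊕ lit 168 ⊗ gap 149<10A ⊕ lit 430)
       ⊕ (gap 14<A ⊕ lit 6) ⊕ lit 8 ⊗ (gap t<1 ⊕ gap e₁<)
       ⊕ lit 800 ⊗ 0<A ⊗ (0<u ⊗ 0<u ⊗ (lit 2 ⊗ 0<A ⊕ lit 3) ⊕ 0<u ⊗ 0<u ⊗ 0<u))
      (solve (A ∷ u ∷ t ∷ []) ℚ-ring)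

    19<10u[A+2] : 19 < 10 * u * (A + 2)
    19<10u[A+2] = certify (lit 51200 ⊗ 0<A ⊗ (0<A ⊕ lit 1))
      (lit 100 ⊗ 0<A ⊗ (lit 352 ⊗ 0<A ⊕ lit 10240 ⊗ 0<u
         ⊕ gap 8u<1 ⊗ (lit 80 ⊗ (lit 2 ⊗ 0<A ⊕ lit 3) ⊗ (lit 1 ⊕ lit 8 ⊗ 0<u)
                       ⊕ lit 10 ⊗ (lit 1 ⊕ lit 8 ⊗ 0<u ⊕ lit 64 ⊗ 0<u ⊗ 0<u)))
       ⊕ (lit 533080 ⊗ 0<A ⊕ lit 5120 ⊗ (gap 14<A ⊕ lit 13))
       ⊕ lit 5120 ⊗ (gap e₁> ⊕ gap t<1))
      (solve (A ∷ u ∷ t ∷ []) ℚ-ring)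

    10s<1 : 10 * s < 1
    10s<1 = certify (lit 10 ⊗ 0<A ⊗ (0<A ⊕ lit 1) ⊗ gap s<1 ⊕ lit 10 ⊗ 0<A)
      ((gap 149<10A ⊕ lit 148) ⊕ (gap t<1 ⊕ gap e₃<)
       ⊕ lit 10 ⊗ 0<A ⊗ gap s<1 ⊗ (gap 14<A ⊕ lit 5 ⊕ lit 10 ⊗ 0<s ⊗ 0<s))
      (solve (A ∷ s ∷ t ∷ []) ℚ-ring)

    5[A+3]s<6 : 5 * (A + 3) * s < 6
    5[A+3]s<6 = certify (0<A ⊗ (lit 90 ⊗ 0<A ⊕ lit 299))
      (lit 40 ⊗ 0<A ⊗ 0<A ⊕ lit 287 ⊗ 0<A ⊕ (lit 2 ⊗ gap 14<A ⊕ lit 13)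
       ⊕ lit 5 ⊗ (0<A ⊕ lit 3) ⊗ (gap t<1 ⊕ gap e₃<
         ⊕ 0<A ⊗ 0<s ⊗ gap 10s<1 ⊗ (lit 10 ⊗ 0<A ⊕ lit 1 ⊕ lit 10 ⊗ 0<s)))
      (solve (A ∷ s ∷ t ∷ []) ℚ-ring)

    9<10[A+3]s : 9 < 10 * (A + 3) * s
    9<10[A+3]s = certify (lit 10 ⊗ 0<A)
      (gap 149<10A ⊕ lit 148 ⊕ gap t<1 ⊕ gap e₃>
       ⊕ lit 100 ⊗ 0<A ⊗ 0<s ⊗ 0<s ⊗ (0<A ⊕ 0<s))
      (solve (A ∷ s ∷ t ∷ []) ℚ-ring)

    t<u : t < u
    t<u = certify (lit 700 ⊗ 0<A ⊗ (0<A ⊕ lit 2))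
      (lit 70 ⊗ 0<A ⊗ gap 19<10u[A+2] ⊕ lit 7 ⊗ (gap e₂> ⊕ gap t<1)
       ⊕ lit 700 ⊗ 0<A ⊗ 0<t ⊗ 0<t ⊗ (0<A ⊕ lit 3 ⊕ 0<t)
       ⊕ lit 100 ⊗ 0<A ⊗ gap 14t<1 ⊕ (lit 529 ⊗ 0<A ⊕ gap 14<A ⊕ lit 7))
      (solve (A ∷ u ∷ t ∷ []) ℚ-ring)

    s<u : s < u
    s<u = certify (lit 10 ⊗ (0<A ⊕ lit 2))
      (gap 19<10u[A+2] ⊕ lit 7 ⊕ lit 2 ⊗ gap 5[A+3]s<6 ⊕ lit 10 ⊗ 0<s)
      (solve (A ∷ u ∷ s ∷ []) ℚ-ring)

    4<[4A+5]t+4t² : 4 < (4 * A + 5) * t + 4 * t * t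
    4<[4A+5]t+4t² = certify (lit 700 ⊗ 0<A)
      (0<t ⊗ (lit 296 ⊗ 0<A ⊕ lit 4 ⊗ gap 14<A ⊕ lit 400 ⊗ 0<A ⊗ gap 14t<1
              ⊕ lit 28 ⊗ (gap t<1 ⊕ gap e₂>)
              ⊕ lit 2800 ⊗ 0<A ⊗ 0<t ⊗ 0<t ⊗ (0<A ⊕ lit 2 ⊕ 0<t))
       ⊕ lit 28 ⊗ gap e₂<)
      (solve (A ∷ t ∷ []) ℚ-ring)

    1<[A+2]t : 1 < (A + 2) * t
    1<[A+2]t = certify (lit 56)
      (lit 14 ⊗ gap 4<[4A+5]t+4t² ⊕ 0<t ⊗ (lit 38 ⊕ lit 4 ⊗ gap 14t<1))
      (solve (A ∷ t ∷ []) ℚ-ring)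

    -- The ring solver does not unfold definitions, so evaluations at A+1+u, −1−t, −s
    -- are written out.
    γ₁-bound : 10 * (A * A + A + 8 + (A * A - A + 1) * (A + 1 + u)
      + (2 - A) * ((A + 1 + u) * (A + 1 + u))) + t <
      10 * ((A + 2) * (A + 2))
    γ₁-bound = certify (lit 1)
      ((gap 14<A ⊕ lit 11) ⊗ gap 19<10u[A+2] ⊕ lit 19 ⊗ gap 14<A ⊕ lit 138
       ⊕ gap t<1 ⊕ lit 10 ⊗ 0<u ⊗ (lit 1 ⊕ (gap 14<A ⊕ lit 12) ⊗ 0<u))
      (solve (A ∷ u ∷ t ∷ []) ℚ-ring)

    -t<16Ae₂ : - t < 16 * A * (1 - A * t - (A + 3) * t * t - t * t * t)
    -t<16Ae₂ = certify (lit 25)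
      (lit 4 ⊗ gap e₂> ⊕ lit 21 ⊗ 0<t)
      (solve (A ∷ t ∷ []) ℚ-ring)

    γ₂-gap : 2 < 16 * A + 24 - (16 * A * A + 32 * A + 23) * t - 16 * A * t * t
    γ₂-gap = certify (lit 7 ⊗ 0<A)
      (lit 29 ⊗ 0<A ⊕ gap 14<A ⊕ lit 13 ⊕ (lit 12 ⊗ 0<A ⊕ lit 1) ⊗ gap 14t<1
       ⊕ lit 7 ⊗ (lit 16 ⊗ 0<A ⊗ (gap 1<[A+2]t ⊗ ((0<A ⊕ lit 2) ⊗ 0<t ⊕ lit 1)
                                   ⊕ 0<t ⊗ 0<t ⊗ (lit 2 ⊕ (0<A ⊕ lit 2) ⊗ 0<t))
                  ⊕ (0<A ⊕ lit 2) ⊗ gap -t<16Ae₂))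
      (solve (A ∷ t ∷ []) ℚ-ring)

    γ₂-bound : 160 * (A * A + A + 8 + (A * A - A + 1) * (- 1 - t)
      + (2 - A) * ((- 1 - t) * (- 1 - t))) + 16 * t <
      10 * ((12 + 3 * t) * (12 + 3 * t))
    γ₂-bound = certify (lit 5)
      (lit 50 ⊗ 0<t ⊗ gap γ₂-gap ⊕ lit 8 ⊗ gap e₂< ⊕ lit 12 ⊗ 0<t)
      (solve (A ∷ t ∷ []) ℚ-ring)

    γ₃-bound : 40 * (A * A + A + 8 + (A * A - A + 1) * (- s)
      + (2 - A) * ((- s) * (- s))) + 4 * t <
      10 * ((2 * A + 1) * (2 * A + 1))
    γ₃-bound = certify (lit 1)
      (lit 4 ⊗ ((gap 14<A ⊕ lit 10) ⊗ gap 9<10[A+3]s ⊕ lit 130 ⊗ 0<s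
                ⊕ lit 10 ⊗ (gap 14<A ⊕ lit 12) ⊗ 0<s ⊗ 0<s ⊕ gap t<1)
       ⊕ lit 36 ⊗ gap 14<A ⊕ lit 46)
      (solve (A ∷ s ∷ t ∷ []) ℚ-ring)

    0<r₁-r₂ : 0 < A + 2 + u + t
    0<r₁-r₂ = 0<A ⊕ lit 2 ⊕ 0<u ⊕ 0<t

    0<r₁-r₃ : 0 < A + 1 + u + s
    0<r₁-r₃ = 0<A ⊕ lit 1 ⊕ 0<u ⊕ 0<s

    0<r₃-r₂ : 0 < 1 - s + t
    0<r₃-r₂ = gap s<1 ⊕ 0<t

    -- A common denominator of the coefficients in Lagrange interpolation.
    0<disc : 0 < (A + 2 + u + t) * (A + 1 + u + s) * (1 - s + t)
    0<disc = 0<r₁-r₂ ⊗ 0<r₁-r₃ ⊗ 0<r₃-r₂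

    -- The bounds A+2, 3+3t/4, A+1/2 with their denominators cleared.
    record Box (X Y Z : ℚ) : Set where
      field
        ev₁< : X + Y * (A + 1 + u) + Z * ((A + 1 + u) * (A + 1 + u)) < A + 2
        ev₁> : - (A + 2) < X + Y * (A + 1 + u) + Z * ((A + 1 + u) * (A + 1 + u))
        ev₂< : 4 * (X + Y * (- 1 - t) + Z * ((- 1 - t) * (- 1 - t))) < 12 + 3 * t
        ev₂> : - (12 + 3 * t) < 4 * (X + Y * (- 1 - t) + Z * ((- 1 - t) * (- 1 - t)))
        ev₃< : 2 * (X + Y * (- s) + Z * ((- s) * (- s))) < 2 * A + 1
        ev₃> : - (2 * A + 1) < 2 * (X + Y * (- s) + Z * ((- s) * (- s)))

    Box-neg : ∀ {X Y Z} → Box X Y Z → Box (- X) (- Y) (- Z)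
    Box-neg {X} {Y} {Z} b = record
      { ev₁< = certify (lit 1) (gap ev₁>) (solve (A ∷ u ∷ X ∷ Y ∷ Z ∷ []) ℚ-ring)
      ; ev₁> = certify (lit 1) (gap ev₁<) (solve (A ∷ u ∷ X ∷ Y ∷ Z ∷ []) ℚ-ring)
      ; ev₂< = certify (lit 1) (gap ev₂>) (solve (t ∷ X ∷ Y ∷ Z ∷ []) ℚ-ring)
      ; ev₂> = certify (lit 1) (gap ev₂<) (solve (t ∷ X ∷ Y ∷ Z ∷ []) ℚ-ring)
      ; ev₃< = certify (lit 1) (gap ev₃>) (solve (A ∷ s ∷ X ∷ Y ∷ Z ∷ []) ℚ-ring)
      ; ev₃> = certify (lit 1) (gap ev₃<) (solve (A ∷ s ∷ X ∷ Y ∷ Z ∷ []) ℚ-ring)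
      }
      where open Box b

    box : ∀ {X Y Z} →
      10 * ((X + Y * (A + 1 + u) + Z * ((A + 1 + u) * (A + 1 + u)))
          * (X + Y * (A + 1 + u) + Z * ((A + 1 + u) * (A + 1 + u)))) <
        10 * (A * A + A + 8 + (A * A - A + 1) * (A + 1 + u)
          + (2 - A) * ((A + 1 + u) * (A + 1 + u))) + t →
      10 * ((X + Y * (- 1 - t) + Z * ((- 1 - t) * (- 1 - t)))
          * (X + Y * (- 1 - t) + Z * ((- 1 - t) * (- 1 - t)))) <
        10 * (A * A + A + 8 + (A * A - A + 1) * (- 1 - t)
          + (2 - A) * ((- 1 - t) * (- 1 - t))) + t →
      10 * ((X + Y * (- s) + Z * ((- s) * (- s)))
          * (X + Y * (- s) + Z * ((- s) * (- s)))) <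
        10 * (A * A + A + 8 + (A * A - A + 1) * (- s) + (2 - A) * ((- s) * (- s))) + t →
      Box X Y Z
    box {X} {Y} {Z} h₁ h₂ h₃ = record
      { ev₁< = proj₂ b₁ ; ev₁> = proj₁ b₁
      ; ev₂< = proj₂ b₂ ; ev₂> = proj₁ b₂
      ; ev₃< = proj₂ b₃ ; ev₃> = proj₁ b₃
      }
      where
      scale₄ : ∀ w g → 10 * (w * w) < 10 * g + t →
        10 * ((4 * w) * (4 * w)) < 160 * g + 16 * t
      scale₄ w g h = certify (lit 1) (lit 16 ⊗ gap h) (solve (w ∷ g ∷ t ∷ []) ℚ-ring)
      scale₂ : ∀ w g → 10 * (w * w) < 10 * g + t →
        10 * ((2 * w) * (2 * w)) < 40 * g + 4 * t
      scale₂ w g h = certify (lit 1) (lit 4 ⊗ gap h) (solve (w ∷ g ∷ t ∷ []) ℚ-ring)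
      w₁ w₂ w₃ g₂ g₃ : ℚ
      w₁ = X + Y * (A + 1 + u) + Z * ((A + 1 + u) * (A + 1 + u))
      w₂ = X + Y * (- 1 - t) + Z * ((- 1 - t) * (- 1 - t))
      w₃ = X + Y * (- s) + Z * ((- s) * (- s))
      g₂ = A * A + A + 8 + (A * A - A + 1) * (- 1 - t) + (2 - A) * ((- 1 - t) * (- 1 - t))
      g₃ = A * A + A + 8 + (A * A - A + 1) * (- s) + (2 - A) * ((- s) * (- s))
      b₁ = square-bound 10 w₁ (A + 2) (lit 10) (0<A ⊕ lit 2) (<-trans h₁ γ₁-bound)
      b₂ = square-bound 10 (4 * w₂) (12 + 3 * t) (lit 10) (lit 12 ⊕ lit 3 ⊗ 0<t)
        (<-trans (scale₄ w₂ g₂ h₂) γ₂-bound)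
      b₃ = square-bound 10 (2 * w₃) (2 * A + 1) (lit 10) (lit 2 ⊗ 0<A ⊕ lit 1)
        (<-trans (scale₂ w₃ g₃ h₃) γ₃-bound)

    Y+Z[r₁+r₂]<2 : ∀ {X Y Z} → Box X Y Z → Y + Z * (A + u - t) < 2
    Y+Z[r₁+r₂]<2 {X} {Y} {Z} b = certify (lit 4 ⊗ 0<r₁-r₂)
      (lit 4 ⊗ gap ev₁< ⊕ gap ev₂> ⊕ (lit 4 ⊗ gap 14<A ⊕ lit 52 ⊕ lit 8 ⊗ 0<u ⊕ lit 5 ⊗ 0<t))
      (solve (A ∷ u ∷ t ∷ X ∷ Y ∷ Z ∷ []) ℚ-ring)
      where open Box b

    -5[A+4]<4[Y+Z[r₂+r₃]] : ∀ {X Y Z} → Box X Y Z → - (5 * (A + 4)) < 4 * (Y - Z * (1 + t + s))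
    -5[A+4]<4[Y+Z[r₂+r₃]] {X} {Y} {Z} b = certify (lit 2 ⊗ 0<r₃-r₂)
      (lit 4 ⊗ gap ev₃> ⊕ lit 2 ⊗ gap ev₂< ⊕ (0<A ⊕ lit 4) ⊗ (gap 10s<1 ⊕ lit 10 ⊗ 0<t)
        ⊕ gap 14<A ⊕ lit 16 ⊕ lit 6 ⊗ gap t<1)
      (solve (A ∷ s ∷ t ∷ X ∷ Y ∷ Z ∷ []) ℚ-ring)
      where open Box b

    Z<2 : ∀ {X Y Z} → Box X Y Z → Z < 2
    Z<2 {X} {Y} {Z} b = certify (lit 4 ⊗ 0<r₁-r₃)
      (lit 4 ⊗ gap (Y+Z[r₁+r₂]<2 b) ⊕ gap (-5[A+4]<4[Y+Z[r₂+r₃]] b) ⊕ lit 3 ⊗ gap 14<A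
        ⊕ lit 22 ⊕ lit 8 ⊗ (0<u ⊕ 0<s))
      (solve (A ∷ u ∷ t ∷ s ∷ Y ∷ Z ∷ []) ℚ-ring)

    Y<2 : ∀ {X Y} → Box X Y 0 → Y < 2
    Y<2 {X} {Y} b = certify (lit 4 ⊗ 0<r₁-r₂)
      (lit 4 ⊗ gap ev₁< ⊕ gap ev₂> ⊕ (lit 4 ⊗ gap 14<A ⊕ lit 52 ⊕ lit 8 ⊗ 0<u ⊕ lit 5 ⊗ 0<t))
      (solve (A ∷ u ∷ t ∷ X ∷ Y ∷ []) ℚ-ring)
      where open Box b

    Y+A<2 : ∀ {X Y} → Box X Y 1 → Y + A < 2
    Y+A<2 {X} {Y} b = certify (lit 4 ⊗ 0<r₁-r₂)
      (lit 4 ⊗ gap ev₁< ⊕ gap ev₂> ⊕ (lit 4 ⊗ gap 14<A ⊕ lit 52 ⊕ lit 8 ⊗ 0<u ⊕ lit 5 ⊗ 0<t)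
       ⊕ lit 4 ⊗ 0<r₁-r₂ ⊗ gap t<u)
      (solve (A ∷ u ∷ t ∷ X ∷ Y ∷ []) ℚ-ring)
      where open Box b

    -2<Y+A : ∀ {X Y} → Box X Y 1 → - 2 < Y + A
    -2<Y+A {X} {Y} b = certify (lit 8 ⊗ 0<r₁-r₂)
      (lit 8 ⊗ gap ev₁> ⊕ lit 2 ⊗ gap ev₂< ⊕ (lit 7 ⊗ gap 14<A ⊕ lit 88 ⊕ lit 15 ⊗ 0<u
        ⊕ lit 9 ⊗ 0<t)
       ⊕ 0<r₁-r₂ ⊗ (lit 8 ⊗ 0<t ⊕ gap 8u<1))
      (solve (A ∷ u ∷ t ∷ X ∷ Y ∷ []) ℚ-ring)
      where open Box b

    [X,1-A,1]⇒X+A<-17/10 : ∀ {X} → Box X (1 - A) 1 → 10 * (X + A) < - 17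
    [X,1-A,1]⇒X+A<-17/10 {X} b = certify (lit 1)
      (lit 10 ⊗ gap ev₁< ⊕ gap 19<10u[A+2] ⊕ lit 2 ⊕ lit 10 ⊗ 0<u ⊗ (lit 1 ⊕ 0<u))
      (solve (A ∷ u ∷ X ∷ []) ℚ-ring)
      where open Box b

    [X,1-A,1]⇒-17/10<X+A : ∀ {X} → Box X (1 - A) 1 → - 17 < 10 * (X + A)
    [X,1-A,1]⇒-17/10<X+A {X} b = certify (lit 1)
      (lit 5 ⊗ gap ev₃> ⊕ lit 2 ⊗ gap 5[A+3]s<6 ⊕ lit 30 ⊗ 0<s ⊕ lit 10 ⊗ 0<s ⊗ gap s<1)
      (solve (A ∷ s ∷ X ∷ []) ℚ-ring)
      where open Box b

    [X,0,0]⇒X<4 : ∀ {X} → Box X 0 0 → X < 4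
    [X,0,0]⇒X<4 {X} b = certify (lit 4)
      (gap ev₂< ⊕ lit 3 ⊗ gap t<1 ⊕ lit 1)
      (solve (t ∷ X ∷ []) ℚ-ring)
      where open Box b

    [X,1,0]⇒X<1 : ∀ {X} → Box X 1 0 → X < 1
    [X,1,0]⇒X<1 {X} b = certify (lit 1)
      (gap ev₁< ⊕ 0<u)
      (solve (A ∷ u ∷ X ∷ []) ℚ-ring)
      where open Box b

    [X,1,0]⇒-2<X : ∀ {X} → Box X 1 0 → - 2 < X
    [X,1,0]⇒-2<X {X} b = certify (lit 4)
      (gap ev₂> ⊕ 0<t)
      (solve (t ∷ X ∷ []) ℚ-ring)
      where open Box b

    [X,-A,1]⇒X+A<1 : ∀ {X} → Box X (0 - A) 1 → X + A < 1
    [X,-A,1]⇒X+A<1 {X} b = certify (lit 4)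
      (gap ev₂< ⊕ gap 4<[4A+5]t+4t²)
      (solve (A ∷ t ∷ X ∷ []) ℚ-ring)
      where open Box b

    [X,-A,1]⇒-2<X+A : ∀ {X} → Box X (0 - A) 1 → - 2 < X + A
    [X,-A,1]⇒-2<X+A {X} b = certify (lit 10)
      (lit 5 ⊗ gap ev₃> ⊕ lit 2 ⊗ gap 5[A+3]s<6 ⊕ lit 3 ⊕ lit 20 ⊗ 0<s ⊕ lit 10 ⊗ 0<s ⊗ gap s<1)
      (solve (A ∷ s ∷ X ∷ []) ℚ-ring)
      where open Box b

    [X,-1-A,1]⇒X+A<0 : ∀ {X} → Box X (- 1 - A) 1 → X + A < 0
    [X,-1-A,1]⇒X+A<0 {X} b = certify (lit 4)
      (gap ev₂< ⊕ gap 4<[4A+5]t+4t² ⊕ lit 4 ⊗ 0<t)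
      (solve (A ∷ t ∷ X ∷ []) ℚ-ring)
      where open Box b

    [X,-1-A,1]⇒-2<X+A : ∀ {X} → Box X (- 1 - A) 1 → - 2 < X + A
    [X,-1-A,1]⇒-2<X+A {X} b = certify (lit 10)
      (lit 5 ⊗ gap ev₃> ⊕ lit 2 ⊗ gap 5[A+3]s<6 ⊕ lit 3 ⊕ lit 10 ⊗ 0<s ⊕ lit 10 ⊗ 0<s ⊗ gap s<1)
      (solve (A ∷ s ∷ X ∷ []) ℚ-ring)
      where open Box b

    +++⇒0<X+2Z : ∀ X Y Z →
      0 < X + Y * (A + 1 + u) + Z * ((A + 1 + u) * (A + 1 + u)) →
      0 < X + Y * (- 1 - t) + Z * ((- 1 - t) * (- 1 - t)) →
      0 < X + Y * (- s) + Z * ((- s) * (- s)) →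
      0 < X + 2 * Z
    +++⇒0<X+2Z X Y Z h₁ h₂ h₃ = certify (lit 40 ⊗ 0<disc)
      (lit 40 ⊗ 0<r₃-r₂ ⊗ ((lit 1 ⊕ 0<t) ⊗ 0<s ⊕ lit 2) ⊗ gap h₁
       ⊕ 0<r₁-r₃ ⊗ (lit 8 ⊗ gap 5[A+3]s<6 ⊕ lit 32 ⊕ lit 5 ⊗ 0<s ⊗ (gap 8u<1 ⊕ lit 15)) ⊗ gap h₂
       ⊕ lit 40 ⊗ 0<r₁-r₂ ⊗ (gap 14<A ⊕ lit 13 ⊕ 0<u ⊕ (0<A ⊕ lit 1 ⊕ 0<u) ⊗ 0<t) ⊗ gap h₃)
      (solve (A ∷ u ∷ t ∷ s ∷ X ∷ Y ∷ Z ∷ []) ℚ-ring)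

    +--⇒0<Y+[A+1]Z : ∀ X Y Z →
      0 < X + Y * (A + 1 + u) + Z * ((A + 1 + u) * (A + 1 + u)) →
      X + Y * (- 1 - t) + Z * ((- 1 - t) * (- 1 - t)) < 0 →
      X + Y * (- s) + Z * ((- s) * (- s)) < 0 →
      0 < Y + (A + 1) * Z
    +--⇒0<Y+[A+1]Z X Y Z h₁ h₂ h₃ = certify (lit 8 ⊗ 0<disc)
      (lit 8 ⊗ 0<r₃-r₂ ⊗ (0<A ⊕ lit 2 ⊕ 0<t ⊕ 0<s) ⊗ gap h₁
       ⊕ lit 8 ⊗ 0<r₁-r₃ ⊗ gap s<u ⊗ gap h₂
       ⊕ 0<r₁-r₂ ⊗ (gap 8u<1 ⊕ lit 7 ⊕ lit 8 ⊗ 0<t) ⊗ gap h₃)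
      (solve (A ∷ u ∷ t ∷ s ∷ X ∷ Y ∷ Z ∷ []) ℚ-ring)

    ++-⇒0<Z : ∀ X Y Z →
      0 < X + Y * (A + 1 + u) + Z * ((A + 1 + u) * (A + 1 + u)) →
      0 < X + Y * (- 1 - t) + Z * ((- 1 - t) * (- 1 - t)) →
      X + Y * (- s) + Z * ((- s) * (- s)) < 0 →
      0 < Z
    ++-⇒0<Z X Y Z h₁ h₂ h₃ = certify 0<disc
      (0<r₃-r₂ ⊗ gap h₁ ⊕ 0<r₁-r₃ ⊗ gap h₂ ⊕ 0<r₁-r₂ ⊗ gap h₃)
      (solve (A ∷ u ∷ t ∷ s ∷ X ∷ Y ∷ Z ∷ []) ℚ-ring)

    -+-⇒Y+AZ<0 : ∀ X Y Z →
      X + Y * (A + 1 + u) + Z * ((A + 1 + u) * (A + 1 + u)) < 0 →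
      0 < X + Y * (- 1 - t) + Z * ((- 1 - t) * (- 1 - t)) →
      X + Y * (- s) + Z * ((- s) * (- s)) < 0 →
      Y + A * Z < 0
    -+-⇒Y+AZ<0 X Y Z h₁ h₂ h₃ = certify 0<disc
      (0<r₃-r₂ ⊗ (0<A ⊕ lit 1 ⊕ 0<t ⊕ 0<s) ⊗ gap h₁
       ⊕ 0<r₁-r₃ ⊗ (lit 1 ⊕ gap s<u) ⊗ gap h₂ ⊕ 0<r₁-r₂ ⊗ gap t<u ⊗ gap h₃)
      (solve (A ∷ u ∷ t ∷ s ∷ X ∷ Y ∷ Z ∷ []) ℚ-ring)

    0<ev₁[1,0,0] : 0 < 1 + 0 * (A + 1 + u) + 0 * ((A + 1 + u) * (A + 1 + u))
    0<ev₁[1,0,0] = certify (lit 1)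
      (lit 1)
      (solve (A ∷ u ∷ []) ℚ-ring)

    0<ev₂[1,0,0] : 0 < 1 + 0 * (- 1 - t) + 0 * ((- 1 - t) * (- 1 - t))
    0<ev₂[1,0,0] = certify (lit 1)
      (lit 1)
      (solve (t ∷ []) ℚ-ring)

    0<ev₃[1,0,0] : 0 < 1 + 0 * (- s) + 0 * ((- s) * (- s))
    0<ev₃[1,0,0] = certify (lit 1)
      (lit 1)
      (solve (s ∷ []) ℚ-ring)

    0<ev₁[-1,1,0] : 0 < - 1 + 1 * (A + 1 + u) + 0 * ((A + 1 + u) * (A + 1 + u))
    0<ev₁[-1,1,0] = certify (lit 1)
      (0<A ⊕ 0<u)
      (solve (A ∷ u ∷ []) ℚ-ring)

    ev₂[-1,1,0]<0 : - 1 + 1 * (- 1 - t) + 0 * ((- 1 - t) * (- 1 - t)) < 0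
    ev₂[-1,1,0]<0 = certify (lit 1)
      (lit 2 ⊕ 0<t)
      (solve (t ∷ []) ℚ-ring)

    ev₃[-1,1,0]<0 : - 1 + 1 * (- s) + 0 * ((- s) * (- s)) < 0
    ev₃[-1,1,0]<0 = certify (lit 1)
      (lit 1 ⊕ 0<s)
      (solve (s ∷ []) ℚ-ring)

    0<ev₁[0,1,0] : 0 < 0 + 1 * (A + 1 + u) + 0 * ((A + 1 + u) * (A + 1 + u))
    0<ev₁[0,1,0] = certify (lit 1)
      (0<A ⊕ lit 1 ⊕ 0<u)
      (solve (A ∷ u ∷ []) ℚ-ring)

    ev₂[0,1,0]<0 : 0 + 1 * (- 1 - t) + 0 * ((- 1 - t) * (- 1 - t)) < 0
    ev₂[0,1,0]<0 = certify (lit 1)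
      (lit 1 ⊕ 0<t)
      (solve (t ∷ []) ℚ-ring)

    ev₃[0,1,0]<0 : 0 + 1 * (- s) + 0 * ((- s) * (- s)) < 0
    ev₃[0,1,0]<0 = certify (lit 1)
      (0<s)
      (solve (s ∷ []) ℚ-ring)

    0<ev₁[-1-A,-A,1] : 0 < (- 1 - A) + (0 - A) * (A + 1 + u) + 1 * ((A + 1 + u) * (A + 1 + u))
    0<ev₁[-1-A,-A,1] = certify (lit 1)
      (0<u ⊗ (0<A ⊕ lit 2 ⊕ 0<u))
      (solve (A ∷ u ∷ []) ℚ-ring)

    0<ev₂[-1-A,-A,1] : 0 < (- 1 - A) + (0 - A) * (- 1 - t) + 1 * ((- 1 - t) * (- 1 - t))
    0<ev₂[-1-A,-A,1] = certify (lit 1)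
      (0<t ⊗ (0<A ⊕ lit 2 ⊕ 0<t))
      (solve (A ∷ t ∷ []) ℚ-ring)

    ev₃[-1-A,-A,1]<0 : (- 1 - A) + (0 - A) * (- s) + 1 * ((- s) * (- s)) < 0
    ev₃[-1-A,-A,1]<0 = certify (lit 5)
      (gap 5[A+3]s<6 ⊕ lit 5 ⊗ gap 14<A ⊕ lit 69 ⊕ lit 10 ⊗ 0<s ⊕ lit 5 ⊗ 0<s ⊗ gap s<1)
      (solve (A ∷ s ∷ []) ℚ-ring)

    0<ev₁[-A,-A,1] : 0 < (0 - A) + (0 - A) * (A + 1 + u) + 1 * ((A + 1 + u) * (A + 1 + u))
    0<ev₁[-A,-A,1] = certify (lit 1)
      (0<u ⊗ (0<A ⊕ lit 2 ⊕ 0<u) ⊕ lit 1)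
      (solve (A ∷ u ∷ []) ℚ-ring)

    0<ev₂[-A,-A,1] : 0 < (0 - A) + (0 - A) * (- 1 - t) + 1 * ((- 1 - t) * (- 1 - t))
    0<ev₂[-A,-A,1] = certify (lit 1)
      (0<t ⊗ (0<A ⊕ lit 2 ⊕ 0<t) ⊕ lit 1)
      (solve (A ∷ t ∷ []) ℚ-ring)

    ev₃[-A,-A,1]<0 : (0 - A) + (0 - A) * (- s) + 1 * ((- s) * (- s)) < 0
    ev₃[-A,-A,1]<0 = certify (lit 5)
      (gap 5[A+3]s<6 ⊕ lit 5 ⊗ gap 14<A ⊕ lit 64 ⊕ lit 10 ⊗ 0<s ⊕ lit 5 ⊗ 0<s ⊗ gap s<1)
      (solve (A ∷ s ∷ []) ℚ-ring)

    ev₁[-1-A,-1-A,1]<0 : (- 1 - A) + (- 1 - A) * (A + 1 + u)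
      + 1 * ((A + 1 + u) * (A + 1 + u)) < 0
    ev₁[-1-A,-1-A,1]<0 = certify (lit 64)
      (lit 8 ⊗ 0<A ⊗ (gap 8u<1 ⊕ lit 7) ⊕ gap 8u<1 ⊗ (lit 9 ⊕ lit 8 ⊗ 0<u) ⊕ lit 55)
      (solve (A ∷ u ∷ []) ℚ-ring)

    0<ev₂[-1-A,-1-A,1] : 0 < (- 1 - A) + (- 1 - A) * (- 1 - t) + 1 * ((- 1 - t) * (- 1 - t))
    0<ev₂[-1-A,-1-A,1] = certify (lit 1)
      (0<t ⊗ (0<A ⊕ lit 3 ⊕ 0<t) ⊕ lit 1)
      (solve (A ∷ t ∷ []) ℚ-ring)

    ev₃[-1-A,-1-A,1]<0 : (- 1 - A) + (- 1 - A) * (- s) + 1 * ((- s) * (- s)) < 0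
    ev₃[-1-A,-1-A,1]<0 = certify (lit 5)
      (gap 5[A+3]s<6 ⊕ lit 5 ⊗ gap 14<A ⊕ lit 69 ⊕ lit 5 ⊗ 0<s ⊕ lit 5 ⊗ 0<s ⊗ gap s<1)
      (solve (A ∷ s ∷ []) ℚ-ring)

-- Embedding of ℤ and ℤ[ρ] in ℚ

open RationalEstimates using (Approximation; approximation; module Estimates)

⟦_⟧ : ℤ → ℚ
⟦ i ⟧ = i / 1

⟦⟧≡⁄1 : ∀ i → ⟦ i ⟧ ≡ i ⁄1
⟦⟧≡⁄1 (+ n)    = normalize-coprime (ℕ.sym (ℕ.1-coprimeTo n))
⟦⟧≡⁄1 -[1+ n ] = cong -_ (normalize-coprime (ℕ.sym (ℕ.1-coprimeTo (suc n))))

infix 4 _↦_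
infixl 6 _⟨+⟩_ _⟨-⟩_
infixl 7 _⟨*⟩_

-- A wrapper for ⟦ i ⟧ ≡ p from which both sides can be inferred.
record _↦_ (i : ℤ) (p : ℚ) : Set where
  constructor cast
  field value : ⟦ i ⟧ ≡ p

open _↦_

` : ∀ i → i ↦ ⟦ i ⟧
` i = cast refl

_⟨+⟩_ : ∀ {i j p q} → i ↦ p → j ↦ q → i ℤ.+ j ↦ p + q
_⟨+⟩_ {i} {j} (cast refl) (cast refl) = cast (sym (trans
  (cong₂ _+_ (⟦⟧≡⁄1 i) (⟦⟧≡⁄1 j))
  (cong ⟦_⟧ (cong₂ ℤ._+_ (ℤ.*-identityʳ i) (ℤ.*-identityʳ j)))))

_⟨*⟩_ : ∀ {i j p q} → i ↦ p → j ↦ q → i ℤ.* j ↦ p * q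
_⟨*⟩_ {i} {j} (cast refl) (cast refl) = cast (sym (cong₂ _*_ (⟦⟧≡⁄1 i) (⟦⟧≡⁄1 j)))

⟨-⟩_ : ∀ {i p} → i ↦ p → ℤ.- i ↦ - p
⟨-⟩_ {i} (cast refl) = cast
  (trans (⟦⟧≡⁄1 (ℤ.- i)) (trans (⁄1-neg i) (cong -_ (sym (⟦⟧≡⁄1 i)))))
  where
  ⁄1-neg : ∀ i → (ℤ.- i) ⁄1 ≡ - (i ⁄1)
  ⁄1-neg (+ 0)     = refl
  ⁄1-neg (+ suc n) = refl
  ⁄1-neg -[1+ n ]  = refl

_⟨-⟩_ : ∀ {i j p q} → i ↦ p → j ↦ q → i ℤ.- j ↦ p - q
i ⟨-⟩ j = i ⟨+⟩ (⟨-⟩ j)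

⟦⟧-cancel-< : ∀ {i j} → ⟦ i ⟧ < ⟦ j ⟧ → i ℤ.< j
⟦⟧-cancel-< {i} {j} i<j = subst₂ ℤ._<_ (ℤ.*-identityʳ i) (ℤ.*-identityʳ j)
  (drop-*<* (subst₂ _<_ (⟦⟧≡⁄1 i) (⟦⟧≡⁄1 j) i<j))

⟦⟧-mono-≤ : ∀ {i j} → i ℤ.≤ j → ⟦ i ⟧ ≤ ⟦ j ⟧
⟦⟧-mono-≤ {i} {j} i≤j = subst₂ _≤_ (sym (⟦⟧≡⁄1 i)) (sym (⟦⟧≡⁄1 j))
  (*≤* (subst₂ ℤ._≤_ (sym (ℤ.*-identityʳ i)) (sym (ℤ.*-identityʳ j)) i≤j))

ev : ℚ → ℤ[ρ] → ℚ
ev r ⟨ x , y , z ⟩ = ⟦ x ⟧ + ⟦ y ⟧ * r + ⟦ z ⟧ * (r * r)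

ev-cong : ∀ r {x y z X Y Z} → x ↦ X → y ↦ Y → z ↦ Z →
  ev r ⟨ x , y , z ⟩ ≡ X + Y * r + Z * (r * r)
ev-cong r (cast refl) (cast refl) (cast refl) = refl

-ρ_ : ℤ[ρ] → ℤ[ρ]
-ρ ⟨ x , y , z ⟩ = ⟨ ℤ.- x , ℤ.- y , ℤ.- z ⟩

-ρ-involutive : ∀ ω → -ρ (-ρ ω) ≡ ω
-ρ-involutive ⟨ x , y , z ⟩
  rewrite ℤ.neg-involutive x | ℤ.neg-involutive y | ℤ.neg-involutive z = refl

ev-neg : ∀ r ω → ev r (-ρ ω) ≡ - ev r ω
ev-neg r ⟨ x , y , z ⟩ = trans (ev-cong r (⟨-⟩ ` x) (⟨-⟩ ` y) (⟨-⟩ ` z))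
  (lemma ⟦ x ⟧ ⟦ y ⟧ ⟦ z ⟧)
  where
  lemma : ∀ X Y Z → - X + - Y * r + - Z * (r * r) ≡ - (X + Y * r + Z * (r * r))
  lemma X Y Z = solve (X ∷ Y ∷ Z ∷ r ∷ []) ℚ-ring

-2<i<2⇒i≡-1,0,1 : ∀ {i} → -[1+ 1 ] ℤ.< i → i ℤ.< + 2 → i ≡ -[1+ 0 ] ⊎ i ≡ + 0 ⊎ i ≡ + 1
-2<i<2⇒i≡-1,0,1 { -[1+ 0 ]} _ _ = inj₁ refl
-2<i<2⇒i≡-1,0,1 { + 0 } _ _ = inj₂ (inj₁ refl)
-2<i<2⇒i≡-1,0,1 { + 1 } _ _ = inj₂ (inj₂ refl)
-2<i<2⇒i≡-1,0,1 { -[1+ suc n ]} (ℤ.-<- (s≤s ())) _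
-2<i<2⇒i≡-1,0,1 { + suc (suc n)} _ (ℤ.+<+ (s≤s (s≤s ())))

module _ (a : ℤ) where
  open Arithmetic a

  cubicAt : ℚ → ℚ
  cubicAt r = r * r * r - ⟦ a ⟧ * (r * r) - ⟦ a ℤ.+ + 3 ⟧ * r - ⟦ + 1 ⟧

  -- The quotient of (x + yr + zr²)² by the cubic in r.
  excess : ℤ[ρ] → ℚ → ℚ
  excess ⟨ x , y , z ⟩ r = ⟦ + 2 ⟧ * ⟦ y ⟧ * ⟦ z ⟧ + ⟦ z ⟧ * ⟦ z ⟧ * (r + ⟦ a ⟧)

  ev-square : ∀ r ω → ev r ω * ev r ω ≡ ev r (ω *ρ ω) + excess ω r * cubicAt r
  ev-square r ⟨ x , y , z ⟩ =
    trans (lemma ⟦ a ⟧ ⟦ x ⟧ ⟦ y ⟧ ⟦ z ⟧) (cong₂ _+_ (sym (ev-cong r c₀ c₁ c₂))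
      (cong (λ B → (⟦ + 2 ⟧ * ⟦ y ⟧ * ⟦ z ⟧ + ⟦ z ⟧ * ⟦ z ⟧ * (r + ⟦ a ⟧))
                   * (r * r * r - ⟦ a ⟧ * (r * r) - B * r - ⟦ + 1 ⟧)) (sym (value a+3))))
    where
    a+3      = ` a ⟨+⟩ ` (+ 3)
    y+az     = ` y ⟨+⟩ ` a ⟨*⟩ ` z
    x+[a+3]z = ` x ⟨+⟩ a+3 ⟨*⟩ ` z
    c₀ = ` x ⟨*⟩ ` x ⟨+⟩ ` y ⟨*⟩ ` z ⟨+⟩ ` z ⟨*⟩ y+az
    c₁ = ` x ⟨*⟩ ` y ⟨+⟩ ` y ⟨*⟩ x+[a+3]z ⟨+⟩ ` z ⟨*⟩ (` z ⟨+⟩ a+3 ⟨*⟩ y+az)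
    c₂ = ` x ⟨*⟩ ` z ⟨+⟩ ` y ⟨*⟩ y+az ⟨+⟩ ` z ⟨*⟩ (x+[a+3]z ⟨+⟩ ` a ⟨*⟩ y+az)
    lemma : ∀ A X Y Z →
      (X + Y * r + Z * (r * r)) * (X + Y * r + Z * (r * r)) ≡
      (X * X + Y * Z + Z * (Y + A * Z))
      + (X * Y + Y * (X + (A + ⟦ + 3 ⟧) * Z) + Z * (Z + (A + ⟦ + 3 ⟧) * (Y + A * Z))) * r
      + (X * Z + Y * (Y + A * Z) + Z * (X + (A + ⟦ + 3 ⟧) * Z + A * (Y + A * Z))) * (r * r)
      + (⟦ + 2 ⟧ * Y * Z + Z * Z * (r + A))
        * (r * r * r - A * (r * r) - (A + ⟦ + 3 ⟧) * r - ⟦ + 1 ⟧)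
    lemma A X Y Z = solve (A ∷ X ∷ Y ∷ Z ∷ r ∷ []) ℚ-ring

-- Elements within the bounds and their decompositions

↦-cancel-< : ∀ {i j p q} → i ↦ p → j ↦ q → p < q → i ℤ.< j
↦-cancel-< (cast refl) (cast refl) = ⟦⟧-cancel-<

-2<i<1⇒i≡-1,0 : ∀ {i} → -[1+ 1 ] ℤ.< i → i ℤ.< + 1 → i ≡ -[1+ 0 ] ⊎ i ≡ + 0
-2<i<1⇒i≡-1,0 { -[1+ 0 ]}     _              _                  = inj₁ refl
-2<i<1⇒i≡-1,0 { -[1+ suc n ]} (ℤ.-<- (s≤s ())) _
-2<i<1⇒i≡-1,0 {+ 0}           _              _                  = inj₂ refl
-2<i<1⇒i≡-1,0 {+ suc n}       _              (ℤ.+<+ (s≤s ()))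

-2<i<0⇒i≡-1 : ∀ {i} → -[1+ 1 ] ℤ.< i → i ℤ.< + 0 → i ≡ -[1+ 0 ]
-2<i<0⇒i≡-1 { -[1+ 0 ]}     _              _ = refl
-2<i<0⇒i≡-1 { -[1+ suc n ]} (ℤ.-<- (s≤s ())) _
-2<i<0⇒i≡-1 {+ n}           _              (ℤ.+<+ ())

1+n<4⇒n≡0,1,2 : ∀ {n} → + suc n ℤ.< + 4 → n ≡ 0 ⊎ n ≡ 1 ⊎ n ≡ 2
1+n<4⇒n≡0,1,2 {0} _ = inj₁ refl
1+n<4⇒n≡0,1,2 {1} _ = inj₂ (inj₁ refl)
1+n<4⇒n≡0,1,2 {2} _ = inj₂ (inj₂ refl)
1+n<4⇒n≡0,1,2 {suc (suc (suc n))} (ℤ.+<+ (s≤s (s≤s (s≤s (s≤s ())))))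

shift : ∀ i a {w} → i ℤ.+ a ≡ w → i ≡ w ℤ.- a
shift i a refl = lemma
  where
  lemma : i ≡ i ℤ.+ a ℤ.- a
  lemma = ℤ-Solver.solve (i ∷ a ∷ [])

same-sign⁻ : ∀ w b → w < 0ℚ → 0ℚ < w * b → b < 0ℚ
same-sign⁻ w b w<0 0<wb = certify (gap w<0) 0<wb (solve (w ∷ b ∷ []) ℚ-ring)

module Sampled (a : ℤ) {u t s : ℚ} (approx : Approximation ⟦ a ⟧ u t s) where

  open Arithmetic a
  open Estimates approx

  r₁ r₂ r₃ : ℚ
  r₁ = ⟦ a ⟧ + 1ℚ + u
  r₂ = - 1ℚ - t
  r₃ = - s

  InBox : ℤ[ρ] → Set
  InBox ⟨ x , y , z ⟩ = Box ⟦ x ⟧ ⟦ y ⟧ ⟦ z ⟧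

  InBox-neg : ∀ ω → InBox ω → InBox (-ρ ω)
  InBox-neg ⟨ x , y , z ⟩ b
    rewrite value (⟨-⟩ ` x) | value (⟨-⟩ ` y) | value (⟨-⟩ ` z) = Box-neg b

  data Listed : ℤ[ρ] → Set where
    [1]            : Listed ⟨ + 1 , + 0 , + 0 ⟩
    [2]            : Listed ⟨ + 2 , + 0 , + 0 ⟩
    [3]            : Listed ⟨ + 3 , + 0 , + 0 ⟩
    [-1,1,0]       : Listed ⟨ -[1+ 0 ] , + 1 , + 0 ⟩
    [0,1,0]        : Listed ⟨ + 0 , + 1 , + 0 ⟩
    [-a-1,-a,1]    : Listed ⟨ -[1+ 0 ] ℤ.- a , + 0 ℤ.- a , + 1 ⟩
    [-a,-a,1]      : Listed ⟨ + 0 ℤ.- a , + 0 ℤ.- a , + 1 ⟩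
    [-a-1,-a-1,1]  : Listed ⟨ -[1+ 0 ] ℤ.- a , -[1+ 0 ] ℤ.- a , + 1 ⟩

  listed-z=1 : ∀ x y → InBox ⟨ x , y , + 1 ⟩ → Listed ⟨ x , y , + 1 ⟩
  listed-z=1 x y b = cases (-2<i<2⇒i≡-1,0,1
      (↦-cancel-< (` -[1+ 1 ]) (` y ⟨+⟩ ` a) (-2<Y+A b))
      (↦-cancel-< (` y ⟨+⟩ ` a) (` (+ 2)) (Y+A<2 b)))
    where
    y=-1-a : ∀ {y} → y ≡ -[1+ 0 ] ℤ.- a → InBox ⟨ x , y , + 1 ⟩ → Listed ⟨ x , y , + 1 ⟩
    y=-1-a refl b = subst (λ x → Listed ⟨ x , _ , + 1 ⟩) (sym (shift x a (-2<i<0⇒i≡-1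
        (↦-cancel-< (` -[1+ 1 ]) (` x ⟨+⟩ ` a) ([X,-1-A,1]⇒-2<X+A b′))
        (↦-cancel-< (` x ⟨+⟩ ` a) (` (+ 0)) ([X,-1-A,1]⇒X+A<0 b′)))))
      [-a-1,-a-1,1]
      where b′ = subst (λ Y → Box ⟦ x ⟧ Y 1ℚ) (value (` -[1+ 0 ] ⟨-⟩ ` a)) b
    y=-a : ∀ {y} → y ≡ + 0 ℤ.- a → InBox ⟨ x , y , + 1 ⟩ → Listed ⟨ x , y , + 1 ⟩
    y=-a refl b = x-cases (-2<i<1⇒i≡-1,0
        (↦-cancel-< (` -[1+ 1 ]) (` x ⟨+⟩ ` a) ([X,-A,1]⇒-2<X+A b′))
        (↦-cancel-< (` x ⟨+⟩ ` a) (` (+ 1)) ([X,-A,1]⇒X+A<1 b′)))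
      where
      b′ = subst (λ Y → Box ⟦ x ⟧ Y 1ℚ) (value (` (+ 0) ⟨-⟩ ` a)) b
      x-cases : x ℤ.+ a ≡ -[1+ 0 ] ⊎ x ℤ.+ a ≡ + 0 → Listed ⟨ x , + 0 ℤ.- a , + 1 ⟩
      x-cases (inj₁ e) = subst (λ x → Listed ⟨ x , _ , + 1 ⟩) (sym (shift x a e)) [-a-1,-a,1]
      x-cases (inj₂ e) = subst (λ x → Listed ⟨ x , _ , + 1 ⟩) (sym (shift x a e)) [-a,-a,1]
    y≠1-a : ∀ {y} → y ≡ + 1 ℤ.- a → ¬ InBox ⟨ x , y , + 1 ⟩
    y≠1-a refl b = <-asym ([X,1-A,1]⇒X+A<-17/10 b′) ([X,1-A,1]⇒-17/10<X+A b′)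
      where b′ = subst (λ Y → Box ⟦ x ⟧ Y 1ℚ) (value (` (+ 1) ⟨-⟩ ` a)) b
    cases : y ℤ.+ a ≡ -[1+ 0 ] ⊎ y ℤ.+ a ≡ + 0 ⊎ y ℤ.+ a ≡ + 1 → Listed ⟨ x , y , + 1 ⟩
    cases (inj₁ e)        = y=-1-a (shift y a e) b
    cases (inj₂ (inj₁ e)) = y=-a (shift y a e) b
    cases (inj₂ (inj₂ e)) = ⊥-elim (y≠1-a (shift y a e) b)

  listed-y=1 : ∀ x → InBox ⟨ x , + 1 , + 0 ⟩ → Listed ⟨ x , + 1 , + 0 ⟩
  listed-y=1 x b = cases (-2<i<1⇒i≡-1,0
      (↦-cancel-< (` -[1+ 1 ]) (` x) ([X,1,0]⇒-2<X b))
      (↦-cancel-< (` x) (` (+ 1)) ([X,1,0]⇒X<1 b)))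
    where
    cases : x ≡ -[1+ 0 ] ⊎ x ≡ + 0 → Listed ⟨ x , + 1 , + 0 ⟩
    cases (inj₁ refl) = [-1,1,0]
    cases (inj₂ refl) = [0,1,0]

  listed-x>0 : ∀ n → InBox ⟨ + suc n , + 0 , + 0 ⟩ → Listed ⟨ + suc n , + 0 , + 0 ⟩
  listed-x>0 n b = cases (1+n<4⇒n≡0,1,2 (↦-cancel-< (` (+ suc n)) (` (+ 4)) ([X,0,0]⇒X<4 b)))
    where
    cases : n ≡ 0 ⊎ n ≡ 1 ⊎ n ≡ 2 → Listed ⟨ + suc n , + 0 , + 0 ⟩
    cases (inj₁ refl)        = [1]
    cases (inj₂ (inj₁ refl)) = [2]
    cases (inj₂ (inj₂ refl)) = [3]

  listed-y=z=0 : ∀ x → InBox ⟨ x , + 0 , + 0 ⟩ → x ≢ + 0 →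
    Listed ⟨ x , + 0 , + 0 ⟩ ⊎ Listed (-ρ ⟨ x , + 0 , + 0 ⟩)
  listed-y=z=0 (+ 0)     b x≢0 = ⊥-elim (x≢0 refl)
  listed-y=z=0 (+ suc n) b _   = inj₁ (listed-x>0 n b)
  listed-y=z=0 -[1+ n ]  b _   = inj₂ (listed-x>0 n (InBox-neg ⟨ -[1+ n ] , + 0 , + 0 ⟩ b))

  -<⇒-< : ∀ {i n} → ℤ.- i ℤ.< + suc n → -[1+ n ] ℤ.< i
  -<⇒-< {i} {n} -i<n = subst (-[1+ n ] ℤ.<_) (ℤ.neg-involutive i) (ℤ.neg-mono-< -i<n)

  listed-z=0 : ∀ x y → InBox ⟨ x , y , + 0 ⟩ → ⟨ x , y , + 0 ⟩ ≢ ι (+ 0) →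
    Listed ⟨ x , y , + 0 ⟩ ⊎ Listed (-ρ ⟨ x , y , + 0 ⟩)
  listed-z=0 x y b ω≢0 = cases (-2<i<2⇒i≡-1,0,1
      (-<⇒-< (↦-cancel-< (` (ℤ.- y)) (` (+ 2)) (Y<2 (InBox-neg ⟨ x , y , + 0 ⟩ b))))
      (↦-cancel-< (` y) (` (+ 2)) (Y<2 b)))
    where
    cases : y ≡ -[1+ 0 ] ⊎ y ≡ + 0 ⊎ y ≡ + 1 →
      Listed ⟨ x , y , + 0 ⟩ ⊎ Listed (-ρ ⟨ x , y , + 0 ⟩)
    cases (inj₁ refl)        = inj₂ (listed-y=1 (ℤ.- x) (InBox-neg ⟨ x , y , + 0 ⟩ b))
    cases (inj₂ (inj₁ refl)) = listed-y=z=0 x b λ { refl → ω≢0 refl }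
    cases (inj₂ (inj₂ refl)) = inj₁ (listed-y=1 x b)

  listed : ∀ ω → InBox ω → ω ≢ ι (+ 0) → Listed ω ⊎ Listed (-ρ ω)
  listed ω@(⟨ x , y , z ⟩) b ω≢0 = cases (-2<i<2⇒i≡-1,0,1
      (-<⇒-< (↦-cancel-< (` (ℤ.- z)) (` (+ 2)) (Z<2 (InBox-neg ω b))))
      (↦-cancel-< (` z) (` (+ 2)) (Z<2 b)))
    where
    cases : z ≡ -[1+ 0 ] ⊎ z ≡ + 0 ⊎ z ≡ + 1 → Listed ω ⊎ Listed (-ρ ω)
    cases (inj₁ refl)        = inj₂ (listed-z=1 (ℤ.- x) (ℤ.- y) (InBox-neg ω b))
    cases (inj₂ (inj₁ refl)) = listed-z=0 x y b ω≢0
    cases (inj₂ (inj₂ refl)) = inj₁ (listed-z=1 x y b)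

  SameSigns : ℤ[ρ] → ℤ[ρ] → Set
  SameSigns ω β = 0ℚ < ev r₁ ω * ev r₁ β × 0ℚ < ev r₂ ω * ev r₂ β × 0ℚ < ev r₃ ω * ev r₃ β

  Split : ℤ[ρ] → Set
  Split ω = ∃[ β₁ ] ∃[ β₂ ] (SameSigns ω β₁ × SameSigns ω β₂ × ω ≡ β₁ +ρ β₂)

  SameSigns-neg : ∀ ω β → SameSigns ω β → SameSigns (-ρ ω) (-ρ β)
  SameSigns-neg ω β (h₁ , h₂ , h₃) = flip r₁ h₁ , flip r₂ h₂ , flip r₃ h₃
    where
    neg*neg : ∀ p q → - p * - q ≡ p * q
    neg*neg p q = solve (p ∷ q ∷ []) ℚ-ring
    flip : ∀ r → 0ℚ < ev r ω * ev r β → 0ℚ < ev r (-ρ ω) * ev r (-ρ β)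
    flip r = subst (0ℚ <_) (sym (trans (cong₂ _*_ (ev-neg r ω) (ev-neg r β))
      (neg*neg (ev r ω) (ev r β))))

  Split-neg : ∀ ω → Split ω → Split (-ρ ω)
  Split-neg ω (β₁ , β₂ , h₁ , h₂ , refl) =
    -ρ β₁ , -ρ β₂ , SameSigns-neg ω β₁ h₁ , SameSigns-neg ω β₂ h₂ , -ρ-distrib-+ β₁ β₂
    where
    -ρ-distrib-+ : ∀ α β → -ρ (α +ρ β) ≡ -ρ α +ρ -ρ β
    -ρ-distrib-+ ⟨ x , y , z ⟩ ⟨ x′ , y′ , z′ ⟩
      rewrite ℤ.neg-distrib-+ x x′ | ℤ.neg-distrib-+ y y′ | ℤ.neg-distrib-+ z z′ = refl

  unsplittable : (φ : ℤ[ρ] → ℤ) → (∀ α β → φ (α +ρ β) ≡ φ α ℤ.+ φ β) →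
    ∀ ω → φ ω ≡ + 1 → (∀ β → SameSigns ω β → + 0 ℤ.< φ β) → ¬ Split ω
  unsplittable φ φ-+ ω φω≡1 0<φ (β₁ , β₂ , h₁ , h₂ , refl) =
    ℤ.<-irrefl refl (subst (+ 1 ℤ.<_) (trans (sym (φ-+ β₁ β₂)) φω≡1)
      (ℤ.+-mono-≤-< (ℤ.i<j⇒suc[i]≤j (0<φ β₁ h₁)) (0<φ β₂ h₂)))

  φ₁ φ₂ φ₃ φ₄ : ℤ[ρ] → ℤ
  φ₁ ⟨ x , y , z ⟩ = x ℤ.+ + 2 ℤ.* z
  φ₂ ⟨ x , y , z ⟩ = y ℤ.+ (a ℤ.+ + 1) ℤ.* z
  φ₃ ⟨ x , y , z ⟩ = z
  φ₄ ⟨ x , y , z ⟩ = ℤ.- (y ℤ.+ a ℤ.* z)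

  φ₁-+ : ∀ α β → φ₁ (α +ρ β) ≡ φ₁ α ℤ.+ φ₁ β
  φ₁-+ ⟨ x , _ , z ⟩ ⟨ x′ , _ , z′ ⟩ = lemma x z x′ z′
    where
    lemma : ∀ x z x′ z′ →
      x ℤ.+ x′ ℤ.+ + 2 ℤ.* (z ℤ.+ z′) ≡ x ℤ.+ + 2 ℤ.* z ℤ.+ (x′ ℤ.+ + 2 ℤ.* z′)
    lemma = ℤ-Solver.solve-∀

  φ₂-+ : ∀ α β → φ₂ (α +ρ β) ≡ φ₂ α ℤ.+ φ₂ β
  φ₂-+ ⟨ _ , y , z ⟩ ⟨ _ , y′ , z′ ⟩ = lemma (a ℤ.+ + 1) y z y′ z′
    where
    lemma : ∀ b y z y′ z′ →
      y ℤ.+ y′ ℤ.+ b ℤ.* (z ℤ.+ z′) ≡ y ℤ.+ b ℤ.* z ℤ.+ (y′ ℤ.+ b ℤ.* z′)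
    lemma = ℤ-Solver.solve-∀

  φ₄-+ : ∀ α β → φ₄ (α +ρ β) ≡ φ₄ α ℤ.+ φ₄ β
  φ₄-+ ⟨ _ , y , z ⟩ ⟨ _ , y′ , z′ ⟩ = lemma a y z y′ z′
    where
    lemma : ∀ b y z y′ z′ →
      ℤ.- (y ℤ.+ y′ ℤ.+ b ℤ.* (z ℤ.+ z′)) ≡ ℤ.- (y ℤ.+ b ℤ.* z) ℤ.+ ℤ.- (y′ ℤ.+ b ℤ.* z′)
    lemma = ℤ-Solver.solve-∀

  φ₂≡1 : ∀ x → φ₂ ⟨ x , + 1 , + 0 ⟩ ≡ + 1
  φ₂≡1 x = cong (λ i → + 1 ℤ.+ i) (ℤ.*-zeroʳ (a ℤ.+ + 1))

  φ₄≡1 : ∀ x → φ₄ ⟨ x , -[1+ 0 ] ℤ.- a , + 1 ⟩ ≡ + 1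
  φ₄≡1 x = lemma a
    where
    lemma : ∀ a → ℤ.- (-[1+ 0 ] ℤ.- a ℤ.+ a ℤ.* + 1) ≡ + 1
    lemma = ℤ-Solver.solve-∀

  positive-on⁺⁺⁺ : ∀ ω → 0ℚ < ev r₁ ω → 0ℚ < ev r₂ ω → 0ℚ < ev r₃ ω →
    ∀ β → SameSigns ω β → + 0 ℤ.< φ₁ β
  positive-on⁺⁺⁺ ω s₁ s₂ s₃ β@(⟨ x , y , z ⟩) (h₁ , h₂ , h₃) =
    ↦-cancel-< (` (+ 0)) (` x ⟨+⟩ ` (+ 2) ⟨*⟩ ` z) (+++⇒0<X+2Z ⟦ x ⟧ ⟦ y ⟧ ⟦ z ⟧
      (cancel-pos s₁ h₁) (cancel-pos s₂ h₂) (cancel-pos s₃ h₃))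

  positive-on⁺⁻⁻ : ∀ ω → 0ℚ < ev r₁ ω → ev r₂ ω < 0ℚ → ev r₃ ω < 0ℚ →
    ∀ β → SameSigns ω β → + 0 ℤ.< φ₂ β
  positive-on⁺⁻⁻ ω s₁ s₂ s₃ β@(⟨ x , y , z ⟩) (h₁ , h₂ , h₃) =
    ↦-cancel-< (` (+ 0)) (` y ⟨+⟩ (` a ⟨+⟩ ` (+ 1)) ⟨*⟩ ` z) (+--⇒0<Y+[A+1]Z ⟦ x ⟧ ⟦ y ⟧ ⟦ z ⟧
      (cancel-pos s₁ h₁) (same-sign⁻ (ev r₂ ω) (ev r₂ β) s₂ h₂)
      (same-sign⁻ (ev r₃ ω) (ev r₃ β) s₃ h₃))

  positive-on⁺⁺⁻ : ∀ ω → 0ℚ < ev r₁ ω → 0ℚ < ev r₂ ω → ev r₃ ω < 0ℚ →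
    ∀ β → SameSigns ω β → + 0 ℤ.< φ₃ β
  positive-on⁺⁺⁻ ω s₁ s₂ s₃ β@(⟨ x , y , z ⟩) (h₁ , h₂ , h₃) =
    ↦-cancel-< (` (+ 0)) (` z) (++-⇒0<Z ⟦ x ⟧ ⟦ y ⟧ ⟦ z ⟧
      (cancel-pos s₁ h₁) (cancel-pos s₂ h₂) (same-sign⁻ (ev r₃ ω) (ev r₃ β) s₃ h₃))

  positive-on⁻⁺⁻ : ∀ ω → ev r₁ ω < 0ℚ → 0ℚ < ev r₂ ω → ev r₃ ω < 0ℚ →
    ∀ β → SameSigns ω β → + 0 ℤ.< φ₄ β
  positive-on⁻⁺⁻ ω s₁ s₂ s₃ β@(⟨ x , y , z ⟩) (h₁ , h₂ , h₃) =
    ℤ.neg-mono-< (↦-cancel-< (` y ⟨+⟩ ` a ⟨*⟩ ` z) (` (+ 0)) (-+-⇒Y+AZ<0 ⟦ x ⟧ ⟦ y ⟧ ⟦ z ⟧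
      (same-sign⁻ (ev r₁ ω) (ev r₁ β) s₁ h₁) (cancel-pos s₂ h₂)
      (same-sign⁻ (ev r₃ ω) (ev r₃ β) s₃ h₃)))

  listed-split : ∀ {ω} → Listed ω → Split ω → ω ≡ ι (+ 2) ⊎ ω ≡ ι (+ 3)
  listed-split [2] _ = inj₁ refl
  listed-split [3] _ = inj₂ refl
  listed-split [1] σ = ⊥-elim (unsplittable φ₁ φ₁-+ ω refl
    (positive-on⁺⁺⁺ ω 0<ev₁[1,0,0] 0<ev₂[1,0,0] 0<ev₃[1,0,0]) σ)
    where ω = ⟨ + 1 , + 0 , + 0 ⟩
  listed-split [-1,1,0] σ = ⊥-elim (unsplittable φ₂ φ₂-+ ω (φ₂≡1 -[1+ 0 ])
    (positive-on⁺⁻⁻ ω 0<ev₁[-1,1,0] ev₂[-1,1,0]<0 ev₃[-1,1,0]<0) σ)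
    where ω = ⟨ -[1+ 0 ] , + 1 , + 0 ⟩
  listed-split [0,1,0] σ = ⊥-elim (unsplittable φ₂ φ₂-+ ω (φ₂≡1 (+ 0))
    (positive-on⁺⁻⁻ ω 0<ev₁[0,1,0] ev₂[0,1,0]<0 ev₃[0,1,0]<0) σ)
    where ω = ⟨ + 0 , + 1 , + 0 ⟩
  listed-split [-a-1,-a,1] σ = ⊥-elim (unsplittable φ₃ (λ _ _ → refl) ω refl
    (positive-on⁺⁺⁻ ω
      (subst (0ℚ <_) (sym (value-at r₁)) 0<ev₁[-1-A,-A,1])
      (subst (0ℚ <_) (sym (value-at r₂)) 0<ev₂[-1-A,-A,1])
      (subst (_< 0ℚ) (sym (value-at r₃)) ev₃[-1-A,-A,1]<0)) σ)
    where
    ω = ⟨ -[1+ 0 ] ℤ.- a , + 0 ℤ.- a , + 1 ⟩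
    value-at = λ r → ev-cong r (` -[1+ 0 ] ⟨-⟩ ` a) (` (+ 0) ⟨-⟩ ` a) (` (+ 1))
  listed-split [-a,-a,1] σ = ⊥-elim (unsplittable φ₃ (λ _ _ → refl) ω refl
    (positive-on⁺⁺⁻ ω
      (subst (0ℚ <_) (sym (value-at r₁)) 0<ev₁[-A,-A,1])
      (subst (0ℚ <_) (sym (value-at r₂)) 0<ev₂[-A,-A,1])
      (subst (_< 0ℚ) (sym (value-at r₃)) ev₃[-A,-A,1]<0)) σ)
    where
    ω = ⟨ + 0 ℤ.- a , + 0 ℤ.- a , + 1 ⟩
    value-at = λ r → ev-cong r (` (+ 0) ⟨-⟩ ` a) (` (+ 0) ⟨-⟩ ` a) (` (+ 1))
  listed-split [-a-1,-a-1,1] σ = ⊥-elim (unsplittable φ₄ φ₄-+ ω (φ₄≡1 (-[1+ 0 ] ℤ.- a))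
    (positive-on⁻⁺⁻ ω
      (subst (_< 0ℚ) (sym (value-at r₁)) ev₁[-1-A,-1-A,1]<0)
      (subst (0ℚ <_) (sym (value-at r₂)) 0<ev₂[-1-A,-1-A,1])
      (subst (_< 0ℚ) (sym (value-at r₃)) ev₃[-1-A,-1-A,1]<0)) σ)
    where
    ω = ⟨ -[1+ 0 ] ℤ.- a , -[1+ 0 ] ℤ.- a , + 1 ⟩
    value-at = λ r → ev-cong r (` -[1+ 0 ] ⟨-⟩ ` a) (` -[1+ 0 ] ⟨-⟩ ` a) (` (+ 1))

  squares : ∀ ω → InBox ω → ω ≢ ι (+ 0) → Split ω →
    (ω *ρ ω ≡ ι (+ 4)) ⊎ (ω *ρ ω ≡ ι (+ 9))
  squares ω b ω≢0 σ = cases (listed ω b ω≢0)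
    where
    ±2 : ∀ {ω} → ω ≡ ι (+ 2) ⊎ ω ≡ ι -[1+ 1 ] → ω *ρ ω ≡ ι (+ 4)
    ±2 (inj₁ refl) = refl
    ±2 (inj₂ refl) = refl
    ±3 : ∀ {ω} → ω ≡ ι (+ 3) ⊎ ω ≡ ι -[1+ 2 ] → ω *ρ ω ≡ ι (+ 9)
    ±3 (inj₁ refl) = refl
    ±3 (inj₂ refl) = refl
    neg-≡ : ∀ {α} → -ρ ω ≡ α → ω ≡ -ρ α
    neg-≡ e = trans (sym (-ρ-involutive ω)) (cong -ρ_ e)
    cases : Listed ω ⊎ Listed (-ρ ω) → (ω *ρ ω ≡ ι (+ 4)) ⊎ (ω *ρ ω ≡ ι (+ 9))
    cases (inj₁ l) = Sum.map (λ e → ±2 (inj₁ e)) (λ e → ±3 (inj₁ e)) (listed-split l σ)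
    cases (inj₂ l) = Sum.map (λ e → ±2 (inj₂ (neg-≡ e))) (λ e → ±3 (inj₂ (neg-≡ e)))
      (listed-split l (Split-neg ω σ))

-- Passage from the real roots to rational approximations

p≤∣p∣ : ∀ p → p ≤ ∣ p ∣
p≤∣p∣ p with ∣p∣≡p∨∣p∣≡-p p | ≤-total 0ℚ p
... | inj₁ e | _ = ≤-reflexive (sym e)
... | inj₂ e | inj₁ 0≤p = ≤-reflexive (sym (0≤p⇒∣p∣≡p 0≤p))
... | inj₂ e | inj₂ p≤0 = ≤-trans p≤0 (0≤∣p∣ p)

∣p∣<q⇒-q<p<q : ∀ {p q} → ∣ p ∣ < q → - q < p × p < q
∣p∣<q⇒-q<p<q {p} {q} ∣p∣<q =
  certify (lit 1ℚ) (gap (≤-<-trans (p≤∣p∣ (- p)) (subst (_< q) (sym (∣-p∣≡∣p∣ p)) ∣p∣<q)))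
    (solve (p ∷ q ∷ []) ℚ-ring)
  , ≤-<-trans (p≤∣p∣ p) ∣p∣<q

Eventually : (ℕ → Set) → Set
Eventually P = ∃[ N ] (∀ n → N ℕ.≤ n → P n)

infixr 4 _∧_

_∧_ : ∀ {P Q} → Eventually P → Eventually Q → Eventually (λ n → P n × Q n)
(M , p) ∧ (N , q) = M ℕ.⊔ N , λ n n≥ →
  p n (ℕ.m⊔n≤o⇒m≤o M N n≥) , q n (ℕ.m⊔n≤o⇒n≤o M N n≥)

eventually-map : ∀ {P Q : ℕ → Set} → (∀ n → P n → Q n) → Eventually P → Eventually Q
eventually-map f (N , p) = N , λ n n≥ → f n (p n n≥)

<ℝ⇒< : ∀ x y → x <ℝ y → Eventually (λ n → seq x n < seq y n)
<ℝ⇒< x y (ε , 0<ε , N , h) = N , λ n n≥ → <-≤-trans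
  (certify (lit 1ℚ) 0<ε (lemma (seq x n))) (h n n≥)
  where
  lemma : ∀ p → 1ℚ * (p + ε - p) ≡ ε
  lemma p = solve (p ∷ ε ∷ []) ℚ-ring

vanishing : ∀ y e → e ≈ℝ 0ℝ → ∀ {η} → 0ℚ < η → Eventually (λ n → ∣ seq y n * seq e n ∣ < η)
vanishing y e e≈0 {η} 0<η =
  let B , 0<B , bounded = eventually-bounded (seq y) (cauchy y)
      δ , 0<δ , Bδ≡η    = quotient 0<B 0<η
  in eventually-map
       (λ n (y≤B , e<δ) → subst (∣ seq y n * seq e n ∣ <_) Bδ≡η
         (∣p*q∣-bound {p = seq y n} {q = seq e n} 0<B y≤B
           (subst (λ p → ∣ p ∣ < δ) (+-identityʳ (seq e n)) e<δ)))
       (bounded ∧ e≈0 δ 0<δ)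

same-sign : ∀ x y σ → HasSign x σ → HasSign y σ → Eventually (λ n → 0ℚ < seq x n * seq y n)
same-sign x y Sign.+ 0<x 0<y = eventually-map (λ n (p , q) → p ⊗ q)
  (<ℝ⇒< 0ℝ x 0<x ∧ <ℝ⇒< 0ℝ y 0<y)
same-sign x y Sign.- x<0 y<0 = eventually-map
  (λ n (p , q) → certify (lit 1ℚ) (gap p ⊗ gap q) (lemma (seq x n) (seq y n)))
  (<ℝ⇒< x 0ℝ x<0 ∧ <ℝ⇒< y 0ℝ y<0)
  where
  lemma : ∀ p q → 1ℚ * (p * q - 0ℚ) ≡ (0ℚ - p) * (0ℚ - q)
  lemma p q = solve (p ∷ q ∷ []) ℚ-ring

module _ (a : ℤ) where

  open Arithmetic a

  record Place (ω β₁ β₂ : ℤ[ρ]) (η r : ℚ) : Set where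
    field
      cubic-small  : ∣ ⟦ + 100 ⟧ * ⟦ a ⟧ * cubicAt a r ∣ < η
      excess-small : ∣ ⟦ + 10 ⟧ * excess a ω r * cubicAt a r ∣ < η
      dominated    : ev r (ω *ρ ω) ≤ ev r γ
      same-signs₁  : 0ℚ < ev r ω * ev r β₁
      same-signs₂  : 0ℚ < ev r ω * ev r β₂

  place : ∀ ω β₁ β₂ x {σ η} → cubic a x ≈ℝ 0ℝ → 0ℚ < η →
    Eventually (λ n → ev (seq x n) (ω *ρ ω) ≤ ev (seq x n) γ) →
    HasSign (eval x ω) σ → HasSign (eval x β₁) σ → HasSign (eval x β₂) σ →
    Eventually (λ n → Place ω β₁ β₂ η (seq x n))
  place ω@(⟨ _ , y , z ⟩) β₁ β₂ x {σ} root 0<η dom h h₁ h₂ = eventually-map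
    (λ n (p , q , d , s₁ , s₂) → record
      { cubic-small = p ; excess-small = q ; dominated = d
      ; same-signs₁ = s₁ ; same-signs₂ = s₂ })
    (vanishing (fromℤ (+ 100) *ℝ fromℤ a) (cubic a x) root 0<η
     ∧ vanishing (fromℤ (+ 10) *ℝ (fromℤ (+ 2) *ℝ fromℤ y *ℝ fromℤ z
                   +ℝ fromℤ z *ℝ fromℤ z *ℝ (x +ℝ fromℤ a))) (cubic a x) root 0<η
     ∧ dom
     ∧ same-sign (eval x ω) (eval x β₁) σ h h₁
     ∧ same-sign (eval x ω) (eval x β₂) σ h h₂)

  cubic-bounds : ∀ {ω β₁ β₂ η r} → Place ω β₁ β₂ η r →
    - η < ⟦ + 100 ⟧ * ⟦ a ⟧ * (r * r * r - ⟦ a ⟧ * (r * r) - (⟦ a ⟧ + ⟦ + 3 ⟧) * r - ⟦ + 1 ⟧) ×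
    ⟦ + 100 ⟧ * ⟦ a ⟧ * (r * r * r - ⟦ a ⟧ * (r * r) - (⟦ a ⟧ + ⟦ + 3 ⟧) * r - ⟦ + 1 ⟧) < η
  cubic-bounds {η = η} {r} P = ∣p∣<q⇒-q<p<q (subst (λ B → ∣ ⟦ + 100 ⟧ * ⟦ a ⟧
      * (r * r * r - ⟦ a ⟧ * (r * r) - B * r - ⟦ + 1 ⟧) ∣ < η)
    (value (` a ⟨+⟩ ` (+ 3))) (Place.cubic-small P))

  square-bounded : ∀ {ω β₁ β₂ η t r} → η ≤ t → Place ω β₁ β₂ η r →
    ⟦ + 10 ⟧ * (ev r ω * ev r ω) < ⟦ + 10 ⟧ *
      (⟦ a ⟧ * ⟦ a ⟧ + ⟦ a ⟧ + ⟦ + 8 ⟧ + (⟦ a ⟧ * ⟦ a ⟧ - ⟦ a ⟧ + ⟦ + 1 ⟧) * r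
       + (⟦ + 2 ⟧ - ⟦ a ⟧) * (r * r)) + t
  square-bounded {ω} {t = t} {r} η≤t P = subst₂ _<_
    (trans (sym (distrib (ev r (ω *ρ ω)) (excess a ω r) (cubicAt a r)))
      (cong (⟦ + 10 ⟧ *_) (sym (ev-square a r ω))))
    (cong (λ g → ⟦ + 10 ⟧ * g + t) (ev-cong r
      (` a ⟨*⟩ ` a ⟨+⟩ ` a ⟨+⟩ ` (+ 8)) (` a ⟨*⟩ ` a ⟨-⟩ ` a ⟨+⟩ ` (+ 1)) (` (+ 2) ⟨-⟩ ` a)))
    (+-mono-≤-< (*-monoˡ-≤-nonNeg ⟦ + 10 ⟧ (Place.dominated P))
      (<-≤-trans (proj₂ (∣p∣<q⇒-q<p<q (Place.excess-small P))) η≤t))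
    where
    distrib : ∀ p k c → ⟦ + 10 ⟧ * (p + k * c) ≡ ⟦ + 10 ⟧ * p + ⟦ + 10 ⟧ * k * c
    distrib p k c = solve (p ∷ k ∷ c ∷ []) ℚ-ring

  at-places : + 15 ℤ.≤ a → ∀ ω β₁ β₂ {r₁ r₂ r₃ u t s η} →
    r₁ ≡ ⟦ a ⟧ + 1ℚ + u → r₂ ≡ - 1ℚ - t → r₃ ≡ - s →
    0ℚ < u → 0ℚ < s → s < 1ℚ → 0ℚ < η → η ≤ t → t < 1ℚ →
    Place ω β₁ β₂ η r₁ → Place ω β₁ β₂ η r₂ → Place ω β₁ β₂ η r₃ →
    ω ≢ ι (+ 0) → ω ≡ β₁ +ρ β₂ → (ω *ρ ω ≡ ι (+ 4)) ⊎ (ω *ρ ω ≡ ι (+ 9))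
  at-places 15≤a ω β₁ β₂ {u = u} {t} {s} refl refl refl 0<u 0<s s<1 0<η η≤t t<1 P₁ P₂ P₃ ω≢0 ω≡ =
    squares ω (box (square-bounded η≤t P₁) (square-bounded η≤t P₂) (square-bounded η≤t P₃)) ω≢0
      (β₁ , β₂
      , (same-signs₁ P₁ , same-signs₁ P₂ , same-signs₁ P₃)
      , (same-signs₂ P₁ , same-signs₂ P₂ , same-signs₂ P₃) , ω≡)
    where
    open Place
    149<10a : ⟦ + 149 ⟧ < ⟦ + 10 ⟧ * ⟦ a ⟧
    149<10a = <-≤-trans {j = ⟦ + 150 ⟧} (*<* (ℤ.+<+ ℕ.≤-refl))
      (*-monoˡ-≤-nonNeg ⟦ + 10 ⟧ (⟦⟧-mono-≤ 15≤a))
    approx : Approximation ⟦ a ⟧ u t s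
    approx = approximation 149<10a 0<u 0<s s<1 0<η η≤t t<1
      (cubic-bounds P₁) (cubic-bounds P₂) (cubic-bounds P₃)
    open Sampled a approx using (squares)
    open Estimates approx using (box)

  at-index : + 15 ℤ.≤ a → ∀ ω β₁ β₂ {r₁ r₂ r₃ η} →
    ⟦ a ℤ.+ + 1 ⟧ < r₁ → 0ℚ < η → r₂ + η ≤ ⟦ -[1+ 0 ] ⟧ → ⟦ -[1+ 1 ] ⟧ < r₂ →
    ⟦ -[1+ 0 ] ⟧ < r₃ → r₃ < 0ℚ →
    Place ω β₁ β₂ η r₁ → Place ω β₁ β₂ η r₂ → Place ω β₁ β₂ η r₃ →
    ω ≢ ι (+ 0) → ω ≡ β₁ +ρ β₂ → (ω *ρ ω ≡ ι (+ 4)) ⊎ (ω *ρ ω ≡ ι (+ 9))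
  at-index 15≤a ω β₁ β₂ {r₁} {r₂} {r₃} {η} a+1<r₁ 0<η r₂+η≤-1 -2<r₂ -1<r₃ r₃<0 =
    at-places 15≤a ω β₁ β₂ (r₁≡ ⟦ a ⟧) r₂≡ r₃≡
      (gap (subst (_< r₁) (value (` a ⟨+⟩ ` (+ 1))) a+1<r₁))
      (certify {p = 0ℚ} {q = - r₃} (lit 1ℚ) (gap r₃<0) 0<-r₃)
      (certify {p = - r₃} {q = 1ℚ} (lit 1ℚ) (gap -1<r₃) -r₃<1)
      0<η
      (subst (_≤ - 1ℚ - r₂) η≡ (+-monoˡ-≤ (- r₂) r₂+η≤-1))
      (certify {p = - 1ℚ - r₂} {q = 1ℚ} (lit 1ℚ) (gap -2<r₂) -1-r₂<1)
    where
    r₁≡ : ∀ A → r₁ ≡ A + 1ℚ + (r₁ - (A + 1ℚ))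
    r₁≡ A = solve (A ∷ r₁ ∷ []) ℚ-ring
    r₂≡ : r₂ ≡ - 1ℚ - (- 1ℚ - r₂)
    r₂≡ = solve (r₂ ∷ []) ℚ-ring
    r₃≡ : r₃ ≡ - (- r₃)
    r₃≡ = solve (r₃ ∷ []) ℚ-ring
    η≡ : r₂ + η - r₂ ≡ η
    η≡ = solve (r₂ ∷ η ∷ []) ℚ-ring
    0<-r₃ : 1ℚ * (- r₃ - 0ℚ) ≡ 0ℚ - r₃
    0<-r₃ = solve (r₃ ∷ []) ℚ-ring
    -r₃<1 : 1ℚ * (1ℚ - - r₃) ≡ r₃ - ⟦ -[1+ 0 ] ⟧
    -r₃<1 = solve (r₃ ∷ []) ℚ-ring
    -1-r₂<1 : 1ℚ * (1ℚ - (- 1ℚ - r₂)) ≡ r₂ - ⟦ -[1+ 1 ] ⟧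
    -1-r₂<1 = solve (r₂ ∷ []) ℚ-ring

module _ {a : ℤ} (R : Roots a) where

  open Arithmetic a
  open Embedded R

  eventually-dominated : ∀ ω x → (γ ≻ (ω *ρ ω) → eval x (ω *ρ ω) <ℝ eval x γ) → γ ⪰ (ω *ρ ω) →
    Eventually (λ n → ev (seq x n) (ω *ρ ω) ≤ ev (seq x n) γ)
  eventually-dominated ω x at-x (inj₁ γ≻ω²) =
    eventually-map (λ _ → <⇒≤) (<ℝ⇒< (eval x (ω *ρ ω)) (eval x γ) (at-x γ≻ω²))
  eventually-dominated ω x at-x (inj₂ γ≡ω²) =
    0 , λ n _ → ≤-reflexive (cong (ev (seq x n)) (sym γ≡ω²))

lemma3p4 : (a : ℤ) → + 15 ℤ.≤ a → (R : Roots a) →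
    let open Arithmetic a
        open Embedded R
    in (ω : ℤ[ρ]) → ω ≢ ι (+ 0) → γ ⪰ (ω *ρ ω) →
       (∃[ σ ] Decomposable σ ω) →
       (ω *ρ ω ≡ ι (+ 4)) ⊎ (ω *ρ ω ≡ ι (+ 9))
lemma3p4 a 15≤a R ω ω≢0 γ⪰ω²
  ((σ , σ′ , σ″) , (h , h′ , h″) , β₁ , β₂ , (h₁ , h₁′ , h₁″) , (h₂ , h₂′ , h₂″) , ω≡β₁+β₂) =
  let open Roots R
      η , 0<η , ρ′+η≤-1 = ρ′<-1
      N , at = place a ω β₁ β₂ ρ {σ} ρ-root 0<η
                 (eventually-dominated R ω ρ proj₁ γ⪰ω²) h h₁ h₂
             ∧ place a ω β₁ β₂ ρ′ {σ′} ρ′-root 0<η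
                 (eventually-dominated R ω ρ′ (λ d → proj₁ (proj₂ d)) γ⪰ω²) h′ h₁′ h₂′
             ∧ place a ω β₁ β₂ ρ″ {σ″} ρ″-root 0<η
                 (eventually-dominated R ω ρ″ (λ d → proj₂ (proj₂ d)) γ⪰ω²) h″ h₁″ h₂″
             ∧ <ℝ⇒< (fromℤ (a ℤ.+ + 1)) ρ a+1<ρ
             ∧ ρ′+η≤-1
             ∧ <ℝ⇒< (fromℤ -[1+ 1 ]) ρ′ -2<ρ′
             ∧ <ℝ⇒< (fromℤ -[1+ 0 ]) ρ″ -1<ρ″
             ∧ <ℝ⇒< ρ″ 0ℝ ρ″<0
      P , P′ , P″ , a+1<r , r′+η≤-1 , -2<r′ , -1<r″ , r″<0 = at N ℕ.≤-refl
  in at-index a 15≤a ω β₁ β₂ a+1<r 0<η r′+η≤-1 -2<r′ -1<r″ r″<0 P P′ P″ ω≢0 ω≡β₁+β₂
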